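{- We have $$C_{1324,3412}(x)=\left(\sum_{k\ge 0}a(k)x^k\right)^2,$$ where $a(k)$ is the $k$-th entry of OEIS sequence A005576, i.e. $a(k)=c\left(\tfrac{r(r+1)}{2}-k,\,r\right)$ for all sufficiently large $r$, with $c(N,r)$ the number of convex penny arrangements of $N$ pennies with $r$ pennies in the bottom row.
   Context: A penny arrangement is a configuration of pennies in rows in the plane such that the bottom row is contiguous and each penny in a higher row touches two pennies in the row below it; it is convex if every row is contiguous. Concretely, with $r$ pennies in the bottom row, number the possible positions in row $h$ ($h=0$ is the bottom row, $0\le h\le r-1$) by $1,\dots,r-h$; a penny arrangement is a choice of a set of occupied positions in each row such that row $0$ is fully occupied and, whenever position $j$ in row $h+1$ is occupied, positions $j$ and $j+1$ in row $h$ are occupied. It is convex if the occupied positions in each row form a (possibly empty) interval of consecutive integers. $c(N,r)$ is the number of convex penny arrangements with $N$ pennies in total and $r$ in the bottom row. For fixed $k$ the value $c(r(r+1)/2-k,r)$ is constant for large $r$; this constant is $a(k)$ (the sequence begins $1,1,2,3,4,7,9,13,17,25,\dots$). $\mathrm{av}_n^k(B)$ is the number of permutations in $S_n$ with exactly $k$ inversions (pairs $i<j$ with $\pi_i>\pi_j$) that avoid every pattern in $B$; a permutation avoids a pattern $q$ if it has no subsequence order-isomorphic to $q$. If for every $k\ge0$ there are constants $m_k,c_k(B)$ with $\mathrm{av}_n^k(B)=c_k(B)$ for all $n\ge m_k$, then $(c_k(B))_{k\ge0}$ is the limit sequence of $B$ and $C_B(x)=\sum_{k\ge 0}c_k(B)x^k$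 is its limit generating function; here $B=\{1324,3412\}$. -}

module Defs where

open import Data.Bool using (true; false)
open import Data.Fin as Fin using (Fin; inject₁; #_)
import Data.Fin.Properties as Fin
open import Data.Fin.Subset using (Subset; _∈_; ∣_∣; ⊤)
open import Data.Fin.Subset.Properties using (_∈?_)
open import Data.List as List
  using (List; []; _∷_; length; filter; allFin; cartesianProduct; cartesianProductWith; upTo)
open import Data.List.Relation.Unary.All as All using (All)
open import Data.Nat using (ℕ; zero; suc; _+_; _*_; _∸_; _≤_; _≟_; _/_)
open import Data.Nat.ListAction using (sum)
open import Data.Product using (∃; _×_; _,_; proj₂)
import Data.Unit as Unit
open import Data.Vec using (Vec; []; _∷_; lookup; map)
open import Data.Vec.Relation.Unary.AllPairs using (allPairs?)
open import Data.Vec.Relation.Unary.Unique.Propositional using (Unique)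
import Data.Vec.Properties as Vec
import Data.Bool.Properties as Bool
open import Relation.Binary.PropositionalEquality using (_≡_)
open import Relation.Nullary using (Dec; yes; no; ¬_; ¬?; map′; _×-dec_; _→-dec_)
open import Relation.Unary using (Decidable)

-- All vectors of length n with entries from xs; duplicate-free if xs is.
words : ∀ {A : Set} → List A → ∀ n → List (Vec A n)
words xs zero    = [] ∷ []
words xs (suc n) = cartesianProductWith _∷_ xs (words xs n)

EventuallyEqual : (ℕ → ℕ) → ℕ → Set
EventuallyEqual f c = ∃ λ m → ∀ n → m ≤ n → f n ≡ c

------------------------------------------------------------------------
-- Formal power series, as coefficient sequences (compared with _≗_)

PowerSeries : Set
PowerSeries = ℕ → ℕ

infixl 7 _⊛_
_⊛_ : PowerSeries → PowerSeries → PowerSeries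
(f ⊛ g) n = sum (List.map (λ i → f i * g (n ∸ i)) (upTo (suc n)))

_² : PowerSeries → PowerSeries
f ² = f ⊛ f

------------------------------------------------------------------------
-- Permutations and patterns

-- Permutations are in one-line notation, with positions and values numbered
-- from 0: 1324 is written 0213.

OrderIsomorphic : ∀ {k m n} → Vec (Fin m) k → Vec (Fin n) k → Set
OrderIsomorphic u v = ∀ i j →
  (lookup u i Fin.< lookup u j → lookup v i Fin.< lookup v j) ×
  (lookup v i Fin.< lookup v j → lookup u i Fin.< lookup u j)

orderIsomorphic? : ∀ {k m n} (u : Vec (Fin m) k) (v : Vec (Fin n) k) →
                   Dec (OrderIsomorphic u v)
orderIsomorphic? u v = Fin.all? λ i → Fin.all? λ j →
  ((lookup u i Fin.<? lookup u j) →-dec (lookup v i Fin.<? lookup v j)) ×-dec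
  ((lookup v i Fin.<? lookup v j) →-dec (lookup u i Fin.<? lookup u j))

Increasing : ∀ {m n} → Vec (Fin n) m → Set
Increasing p = ∀ i j → i Fin.< j → lookup p i Fin.< lookup p j

increasing? : ∀ {m n} → Decidable (Increasing {m} {n})
increasing? p = Fin.all? λ i → Fin.all? λ j →
  (i Fin.<? j) →-dec (lookup p i Fin.<? lookup p j)

-- The vector p lists the positions of the subsequence of π.
Contains : ∀ {m n} → Vec (Fin n) n → Vec (Fin m) m → Set
Contains {m} {n} π q = ∃ λ (p : Vec (Fin n) m) →
  Increasing p × OrderIsomorphic (map (lookup π) p) q

anyVec? : ∀ {n m} {P : Vec (Fin n) m → Set} → Decidable P → Dec (∃ P)
anyVec? {m = zero}  P? = map′ ([] ,_) (λ { ([] , p) → p }) (P? [])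
anyVec? {m = suc m} P? =
  map′ (λ { (x , xs , p) → x ∷ xs , p }) (λ { (x ∷ xs , p) → x , xs , p })
       (Fin.any? λ x → anyVec? λ xs → P? (x ∷ xs))

contains? : ∀ {m n} (π : Vec (Fin n) n) (q : Vec (Fin m) m) → Dec (Contains π q)
contains? π q = anyVec? λ p →
  increasing? p ×-dec orderIsomorphic? (map (lookup π) p) q

Pattern : Set
Pattern = ∃ λ m → Vec (Fin m) m

AvoidsAll : ∀ {n} → List Pattern → Vec (Fin n) n → Set
AvoidsAll B π = All (λ q → ¬ Contains π (proj₂ q)) B

avoidsAll? : ∀ {n} (B : List Pattern) → Decidable (AvoidsAll {n} B)
avoidsAll? B π = All.all? (λ q → ¬? (contains? π (proj₂ q))) B

inversions : ∀ {n} → Vec (Fin n) n → ℕ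
inversions {n} π = length (filter inversion? (cartesianProduct (allFin n) (allFin n)))
  where
  inversion? : Decidable λ ((i , j) : Fin n × Fin n) →
               i Fin.< j × lookup π j Fin.< lookup π i
  inversion? (i , j) = (i Fin.<? j) ×-dec (lookup π j Fin.<? lookup π i)

unique? : ∀ {m n} → Decidable (Unique {A = Fin n} {m})
unique? = allPairs? λ x y → ¬? (x Fin.≟ y)

permutations : ∀ n → List (Vec (Fin n) n)
permutations n = filter unique? (words (allFin n) n)

av : ℕ → ℕ → List Pattern → ℕ
av n k B = length (filter (λ π → (inversions π ≟ k) ×-dec avoidsAll? B π) (permutations n))

-- C is both the limit sequence of B and, read as a power series, its
-- limit generating function.
IsLimitSeries : List Pattern → PowerSeries → Set
IsLimitSeries B C = ∀ k → EventuallyEqual (λ n → av n k B) (C k)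

1324,3412 : List Pattern
1324,3412 = (4 , # 0 ∷ # 2 ∷ # 1 ∷ # 3 ∷ [])
          ∷ (4 , # 2 ∷ # 3 ∷ # 0 ∷ # 1 ∷ [])
          ∷ []

------------------------------------------------------------------------
-- Penny arrangements

-- A set of occupied positions in each row, bottom row first: the rows of a
-- Config r have r, r - 1, …, 1 positions, numbered from 0.
data Config : ℕ → Set where
  []  : Config 0
  _∷_ : ∀ {r} → Subset (suc r) → Config r → Config (suc r)

configs : ∀ r → List (Config r)
configs zero    = [] ∷ []
configs (suc r) =
  cartesianProductWith _∷_ (words (true ∷ false ∷ []) (suc r)) (configs r)

BottomFull : ∀ {r} → Config r → Set
BottomFull []      = Unit.⊤
BottomFull (s ∷ _) = s ≡ ⊤

bottomFull? : ∀ {r} → Decidable (BottomFull {r})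
bottomFull? []      = yes _
bottomFull? (s ∷ _) = Vec.≡-dec Bool._≟_ s ⊤

-- Position j of the upper row rests on positions j and j + 1 of the lower one.
RestsOn : ∀ {r} → Subset r → Subset (suc r) → Set
RestsOn upper lower = ∀ j → j ∈ upper → inject₁ j ∈ lower × Fin.suc j ∈ lower

restsOn? : ∀ {r} (upper : Subset r) (lower : Subset (suc r)) → Dec (RestsOn upper lower)
restsOn? upper lower = Fin.all? λ j →
  (j ∈? upper) →-dec ((inject₁ j ∈? lower) ×-dec (Fin.suc j ∈? lower))

Supported : ∀ {r} → Config r → Set
Supported []                      = Unit.⊤
Supported (_ ∷ [])                = Unit.⊤
Supported (lower ∷ c@(upper ∷ _)) = RestsOn upper lower × Supported c

supported? : ∀ {r} → Decidable (Supported {r})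
supported? []                      = yes _
supported? (_ ∷ [])                = yes _
supported? (lower ∷ c@(upper ∷ _)) = restsOn? upper lower ×-dec supported? c

IsPennyArrangement : ∀ {r} → Config r → Set
IsPennyArrangement c = BottomFull c × Supported c

Interval : ∀ {n} → Subset n → Set
Interval s = ∀ i j l → i Fin.≤ j → j Fin.≤ l → i ∈ s → l ∈ s → j ∈ s

interval? : ∀ {n} → Decidable (Interval {n})
interval? s = Fin.all? λ i → Fin.all? λ j → Fin.all? λ l →
  (i Fin.≤? j) →-dec ((j Fin.≤? l) →-dec
  ((i ∈? s) →-dec ((l ∈? s) →-dec (j ∈? s))))

Convex : ∀ {r} → Config r → Set
Convex []      = Unit.⊤
Convex (s ∷ c) = Interval s × Convex c

convex? : ∀ {r} → Decidable (Convex {r})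
convex? []      = yes _
convex? (s ∷ c) = interval? s ×-dec convex? c

pennies : ∀ {r} → Config r → ℕ
pennies []      = 0
pennies (s ∷ c) = ∣ s ∣ + pennies c

IsConvexPennyArrangement : ∀ {r} → ℕ → Config r → Set
IsConvexPennyArrangement N c = pennies c ≡ N × IsPennyArrangement c × Convex c

isConvexPennyArrangement? : ∀ {r} N → Decidable (IsConvexPennyArrangement {r} N)
isConvexPennyArrangement? N c =
  (pennies c ≟ N) ×-dec ((bottomFull? c ×-dec supported? c) ×-dec convex? c)

numConvex : ℕ → ℕ → ℕ
numConvex N r = length (filter (isConvexPennyArrangement? N) (configs r))

-- The truncation of ∸ is harmless: only large r matter.
IsA005576 : PowerSeries → Set
IsA005576 a = ∀ k → EventuallyEqual (λ r → numConvex (r * (r + 1) / 2 ∸ k) r) (a k)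

{-# OPTIONS --safe #-}
module Submission where

-- A permutation is recorded by its Lehmer code λ. It avoids 132 iff λ is weakly
-- decreasing, and then it avoids 3412 iff moreover no equality λ i = λ (i + 1)
-- is followed by a drop λ j ≥ λ (j + 1) + 2. In terms of f j = λ j + j this says
-- that f rises by at most 1 at each step and has no peak, i.e. that the sets
-- { j : f j < m } are the rows of a convex penny arrangement, where m is the
-- number of positions of the row. Position j is missing from λ j rows, so a
-- permutation with k inversions corresponds to an arrangement with k missing
-- pennies.
--
-- A long permutation with k inversions that avoids 1324 is cut in two summands
-- by every position at distance more than k from both ends: otherwise such a
-- position would lie between two cuts, and an inversion between these extends to
-- a 1324. The first summand avoids 132 and 3412, the second 213 and 3412, and
-- reverse-complementation exchanges these two classes; hence the square.

open import Defs
open import Algebra.Properties.CommutativeSemigroup using (interchange)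
open import Data.Bool using (true; false)
open import Data.Empty using (⊥; ⊥-elim)
open import Data.Fin as Fin using (Fin; toℕ; inject₁; fromℕ<; punchIn; punchOut; opposite; _↑ˡ_)
import Data.Fin.Properties as Fin
open import Data.Fin.Patterns using (0F; 1F; 2F; 3F)
open import Data.Fin.Subset using (Subset; ∣_∣; ⊤) renaming (_∈_ to _∈ₛ_)
open import Data.Fin.Subset.Properties using (∈⊤) renaming (_∈?_ to _∈ₛ?_)
open import Data.List as List using (List; []; _∷_; _++_; length; filter; upTo; allFin; cartesianProduct)
open import Data.List.Membership.Propositional using (_∈_)
import Data.List.Membership.DecPropositional as DecMembership
open import Data.List.Membership.Propositional.Properties
open import Data.List.Properties using (length-++; length-map; length-upTo; length-tabulate)
open import Data.List.Relation.Binary.Subset.Propositional using (_⊆_)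
open import Data.List.Relation.Unary.All as All using ([]; _∷_)
open import Data.List.Relation.Unary.AllPairs using ([]; _∷_)
open import Data.List.Relation.Unary.Any using (here; there)
open import Data.List.Relation.Unary.Unique.Propositional using (Unique)
import Data.List.Relation.Unary.Unique.Propositional.Properties as Unique
open import Data.Nat
open import Data.Nat.DivMod using (m*n/n≡m)
open import Data.Nat.ListAction using (sum)
open import Data.Nat.Properties
open import Data.Nat.Tactic.RingSolver using (solve-∀)
open import Data.Product as Product using (∃; ∃₂; _×_; _,_; proj₁; proj₂; uncurry)
open import Data.Sum using (_⊎_; inj₁; inj₂; [_,_]′)
open import Data.Vec as Vec using (Vec; []; _∷_; lookup; tabulate)
open import Data.Vec.Properties
  using ([]=⇒lookup; lookup⇒[]=; lookup∘tabulate; tabulate∘lookup; tabulate-cong; lookup-map; ∷-injective)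
open import Data.Vec.Relation.Unary.All as VecAll using ([]; _∷_)
import Data.Vec.Relation.Unary.All.Properties as VecAll
open import Data.Vec.Relation.Unary.AllPairs using ([]; _∷_)
open import Data.Vec.Relation.Unary.Unique.Propositional using () renaming (Unique to VecUnique)
import Data.Vec.Relation.Unary.Unique.Propositional.Properties as VecUnique
open import Function using (_∘_; id; case_of_)
open import Relation.Binary.Definitions using (tri<; tri≈; tri>)
open import Relation.Binary.PropositionalEquality
open import Relation.Nullary
open import Relation.Nullary.Decidable using (dec-true; dec-false; decidable-stable)
open import Relation.Unary using (Decidable; U)

-- Cardinalities

-- Pigeonhole: one occurrence of the head is removed from `ys`; the other elements of `xs` differ
-- from it, so they still lie in what remains.
Unique∧⊆⇒length≤ : ∀ {A : Set} {xs ys : List A} → Unique xs → xs ⊆ ys → length xs ≤ length ys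
Unique∧⊆⇒length≤ {xs = []} _ _ = z≤n
Unique∧⊆⇒length≤ {xs = x ∷ xs} (x∉xs ∷ xs!) sub
  with as , bs , refl ← ∈-∃++ (sub (here refl)) = begin
    suc (length xs)              ≤⟨ s≤s (Unique∧⊆⇒length≤ xs! sub′) ⟩
    suc (length (as ++ bs))      ≡⟨ cong suc (length-++ as) ⟩
    suc (length as + length bs)  ≡⟨ +-suc (length as) (length bs) ⟨
    length as + suc (length bs)  ≡⟨ length-++ as ⟨
    length (as ++ x ∷ bs)        ∎
  where
  open ≤-Reasoning
  sub′ : xs ⊆ as ++ bs
  sub′ {y} y∈xs with ∈-++⁻ as (sub (there y∈xs))
  ... | inj₁ y∈as         = ∈-++⁺ˡ y∈as
  ... | inj₂ (here refl)  = ⊥-elim (All.lookup x∉xs y∈xs refl)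
  ... | inj₂ (there y∈bs) = ∈-++⁺ʳ as y∈bs

-- Counting by duplicate-free enumeration lets lists that are built in different ways be compared
-- through a bijection alone.
record Card {A : Set} (P : A → Set) (n : ℕ) : Set where
  constructor card
  field
    elements : List A
    unique   : Unique elements
    sound    : ∀ {x} → x ∈ elements → P x
    complete : ∀ {x} → P x → x ∈ elements
    size     : length elements ≡ n

Card-unique : ∀ {A : Set} {P : A → Set} {m n} → Card P m → Card P n → m ≡ n
Card-unique (card xs xs! P⇐xs P⇒xs refl) (card ys ys! P⇐ys P⇒ys refl) = ≤-antisym
  (Unique∧⊆⇒length≤ xs! (P⇒ys ∘ P⇐xs)) (Unique∧⊆⇒length≤ ys! (P⇒xs ∘ P⇐ys))

Unique-map-∈ : ∀ {A B : Set} (f : A → B) {xs : List A} →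
               (∀ {x y} → x ∈ xs → y ∈ xs → f x ≡ f y → x ≡ y) → Unique xs → Unique (List.map f xs)
Unique-map-∈ f {[]} inj _ = []
Unique-map-∈ f {x ∷ xs} inj (x∉ ∷ xs!) =
  All.tabulate fx∉ ∷ Unique-map-∈ f (λ p q → inj (there p) (there q)) xs!
  where
  fx∉ : ∀ {v} → v ∈ List.map f xs → f x ≢ v
  fx∉ v∈ fx≡v with y , y∈ , refl ← ∈-map⁻ f v∈ =
    All.lookup x∉ y∈ (inj (here refl) (there y∈) fx≡v)

Card-bij : ∀ {A B : Set} {P : A → Set} {Q : B → Set} {n} (f : A → B) →
           (∀ {x} → P x → Q (f x)) →
           (∀ {x y} → P x → P y → f x ≡ f y → x ≡ y) →
           (∀ {y} → Q y → ∃ λ x → P x × f x ≡ y) →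
           Card P n → Card Q n
Card-bij {Q = Q} f P⇒Q inj surj (card xs xs! P⇐xs P⇒xs refl) = card
  (List.map f xs) (Unique-map-∈ f (λ p q → inj (P⇐xs p) (P⇐xs q)) xs!)
  sound′
  (λ Qy → let x , Px , fx≡y = surj Qy in subst (_∈ List.map f xs) fx≡y (∈-map⁺ f (P⇒xs Px)))
  (length-map f xs)
  where
  sound′ : ∀ {y} → y ∈ List.map f xs → Q y
  sound′ y∈ with x , x∈ , refl ← ∈-map⁻ f y∈ = P⇒Q (P⇐xs x∈)

-- Pulls an enumeration back along `f`: surjectivity supplies one preimage per element, so no
-- inverse has to be defined on all of `B`.
Card-bij⁻ : ∀ {A B : Set} {P : A → Set} {Q : B → Set} {n} (f : A → B) →
            (∀ {x} → P x → Q (f x)) →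
            (∀ {x y} → P x → P y → f x ≡ f y → x ≡ y) →
            (∀ {y} → Q y → ∃ λ x → P x × f x ≡ y) →
            Card Q n → Card P n
Card-bij⁻ {A} {P = P} {Q} f P⇒Q inj surj (card ys ys! Q⇐ys Q⇒ys refl) with preimages ys Q⇐ys
  where
  preimages : ∀ ys → (∀ {y} → y ∈ ys → Q y) →
              ∃ λ (xs : List A) → (∀ {x} → x ∈ xs → P x) × List.map f xs ≡ ys
  preimages [] _ = [] , (λ ()) , refl
  preimages (y ∷ ys) Qys
    with x , Px , refl ← surj (Qys (here refl))
       | xs , Pxs , refl ← preimages ys (Qys ∘ there) =
    x ∷ xs , (λ { (here refl) → Px ; (there x∈) → Pxs x∈ }) , refl
... | xs , Pxs , refl = card xs (Unique.map⁻ ys!) Pxs complete′ (sym (length-map f xs))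
  where
  complete′ : ∀ {x} → P x → x ∈ xs
  complete′ Px with x′ , x′∈ , eq ← ∈-map⁻ f (Q⇒ys (P⇒Q Px)) =
    subst (_∈ xs) (inj (Pxs x′∈) Px (sym eq)) x′∈

Card-cong : ∀ {A : Set} {P Q : A → Set} {n} →
            (∀ {x} → P x → Q x) → (∀ {x} → Q x → P x) → Card P n → Card Q n
Card-cong P⇒Q Q⇒P = Card-bij id P⇒Q (λ _ _ eq → eq) (λ Qx → _ , Q⇒P Qx , refl)

Card-filter : ∀ {A : Set} {P R : A → Set} {n} (P? : Decidable P) (C : Card R n) →
              Card (λ x → R x × P x) (length (filter P? (Card.elements C)))
Card-filter P? (card xs xs! snd cmp _) = card (filter P? xs) (Unique.filter⁺ P? xs!)
  (λ x∈ → let x∈xs , Px = ∈-filter⁻ P? x∈ in snd x∈xs , Px)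
  (λ (Rx , Px) → ∈-filter⁺ P? (cmp Rx) Px) refl

Card-⊎ : ∀ {A : Set} {P Q : A → Set} {m n} → (∀ {x} → P x → ¬ Q x) →
         Card P m → Card Q n → Card (λ x → P x ⊎ Q x) (m + n)
Card-⊎ {P = P} {Q} disj (card xs xs! P⇐xs P⇒xs refl) (card ys ys! Q⇐ys Q⇒ys refl) = card
  (xs ++ ys) (Unique.++⁺ xs! ys! λ (x∈xs , x∈ys) → disj (P⇐xs x∈xs) (Q⇐ys x∈ys))
  sound′
  (λ { (inj₁ p) → ∈-++⁺ˡ (P⇒xs p) ; (inj₂ q) → ∈-++⁺ʳ xs (Q⇒ys q) })
  (length-++ xs)
  where
  sound′ : ∀ {x} → x ∈ xs ++ ys → P x ⊎ Q x
  sound′ x∈ with ∈-++⁻ xs x∈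
  ... | inj₁ p = inj₁ (P⇐xs p)
  ... | inj₂ q = inj₂ (Q⇐ys q)

Card-× : ∀ {A B : Set} {P : A → Set} {Q : B → Set} {m n} → Card P m → Card Q n →
         Card (λ (x , y) → P x × Q y) (m * n)
Card-× (card xs xs! P⇐xs P⇒xs refl) (card ys ys! Q⇐ys Q⇒ys refl) = card
  (cartesianProduct xs ys) (Unique.cartesianProduct⁺ xs! ys!)
  (λ xy∈ → Product.map P⇐xs Q⇐ys (∈-cartesianProduct⁻ xs ys xy∈))
  (λ (p , q) → ∈-cartesianProduct⁺ (P⇒xs p) (Q⇒ys q))
  (length-cartesianProduct xs)
  where
  length-cartesianProduct : ∀ xs → length (cartesianProduct xs ys) ≡ length xs * length ys
  length-cartesianProduct []       = refl
  length-cartesianProduct (x ∷ xs) = trans (length-++ (List.map (x ,_) ys))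
    (cong₂ _+_ (length-map (x ,_) ys) (length-cartesianProduct xs))

-- With a product in each disjoint part, this produces the sum in a coefficient of `_⊛_`.
Card-Σ : ∀ {A I : Set} {R : I → A → Set} {u : I → ℕ} (is : List I) → Unique is →
         (∀ {i j x} → R i x → R j x → i ≡ j) → (∀ {i} → i ∈ is → Card (R i) (u i)) →
         Card (λ x → ∃ λ i → i ∈ is × R i x) (sum (List.map u is))
Card-Σ [] _ _ _ = card [] [] (λ ()) (λ ()) refl
Card-Σ {R = R} (i ∷ is) (i∉is ∷ is!) disj C = Card-cong
  (λ { (inj₁ r) → i , here refl , r ; (inj₂ (j , j∈ , r)) → j , there j∈ , r })
  (λ { (_ , here refl , r) → inj₁ r ; (j , there j∈ , r) → inj₂ (j , j∈ , r) })
  (Card-⊎ (λ { r (j , j∈ , r′) → All.lookup i∉is j∈ (disj r r′) })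
          (C (here refl)) (Card-Σ is is! disj (C ∘ there)))

-- Lehmer codes

-- The order-preserving injection that omits the value `x`: `punchIn` without bounds, so that
-- permutations can be continued by the identity.
punch : ℕ → ℕ → ℕ
punch zero    v       = suc v
punch (suc x) zero    = zero
punch (suc x) (suc v) = suc (punch x v)

toℕ-punchIn : ∀ {n} (x : Fin (suc n)) v → toℕ (punchIn x v) ≡ punch (toℕ x) (toℕ v)
toℕ-punchIn Fin.zero    v           = refl
toℕ-punchIn (Fin.suc x) Fin.zero    = refl
toℕ-punchIn (Fin.suc x) (Fin.suc v) = cong suc (toℕ-punchIn x v)

punch-< : ∀ {x v} → v < x → punch x v ≡ v
punch-< {suc x} {zero}  _         = refl
punch-< {suc x} {suc v} (s≤s v<x) = cong suc (punch-< v<x)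

punch-≥ : ∀ {x v} → x ≤ v → punch x v ≡ suc v
punch-≥ {zero}          _         = refl
punch-≥ {suc x} {suc v} (s≤s x≤v) = cong suc (punch-≥ x≤v)

punch-mono-< : ∀ x {v w} → v < w → punch x v < punch x w
punch-mono-< zero                    v<w       = s≤s v<w
punch-mono-< (suc x) {zero}  {suc w} v<w       = s≤s z≤n
punch-mono-< (suc x) {suc v} {suc w} (s≤s v<w) = s≤s (punch-mono-< x v<w)

punch-mono-≤ : ∀ x {v w} → v ≤ w → punch x v ≤ punch x w
punch-mono-≤ x v≤w with m≤n⇒m<n∨m≡n v≤w
... | inj₁ v<w  = <⇒≤ (punch-mono-< x v<w)
... | inj₂ refl = ≤-refl

punch-cancel-< : ∀ x {v w} → punch x v < punch x w → v < w
punch-cancel-< x {v} {w} p with v <? w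
... | yes v<w = v<w
... | no  v≮w = ⊥-elim (<⇒≱ p (punch-mono-≤ x (≮⇒≥ v≮w)))

punch-injective : ∀ x {v w} → punch x v ≡ punch x w → v ≡ w
punch-injective x {v} {w} p with <-cmp v w
... | tri< v<w _ _ = ⊥-elim (<⇒≢ (punch-mono-< x v<w) p)
... | tri≈ _ v≡w _ = v≡w
... | tri> _ _ w<v = ⊥-elim (<⇒≢ (punch-mono-< x w<v) (sym p))

punch-≢ : ∀ x v → punch x v ≢ x
punch-≢ (suc x) (suc v) eq = punch-≢ x v (suc-injective eq)

≤-punch : ∀ x v → v ≤ punch x v
≤-punch zero    v       = n≤1+n v
≤-punch (suc x) zero    = z≤n
≤-punch (suc x) (suc v) = s≤s (≤-punch x v)

punch-≤ : ∀ x v → punch x v ≤ suc v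
punch-≤ zero    v       = ≤-refl
punch-≤ (suc x) zero    = z≤n
punch-≤ (suc x) (suc v) = s≤s (punch-≤ x v)

-- The entry at i counts the inversions whose left end is at i.
infixr 5 _◂_
data Code : ℕ → Set where
  ε   : Code 0
  _◂_ : ∀ {n} → Fin (suc n) → Code n → Code (suc n)

-- A code is extended by zeros and its permutation by the identity.
at : ∀ {n} → Code n → ℕ → ℕ
at ε       _       = 0
at (x ◂ c) zero    = toℕ x
at (x ◂ c) (suc i) = at c i

val : ∀ {n} → Code n → ℕ → ℕ
val ε       i       = i
val (x ◂ c) zero    = toℕ x
val (x ◂ c) (suc i) = punch (toℕ x) (val c i)

weight : ∀ {n} → Code n → ℕ
weight ε       = 0
weight (x ◂ c) = toℕ x + weight c

at-bound : ∀ {n} (c : Code n) {i} → i < n → at c i + i < n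
at-bound {suc n} (x ◂ c) {zero}  _         = subst (_< suc n) (sym (+-identityʳ (toℕ x))) (Fin.toℕ<n x)
at-bound {suc n} (x ◂ c) {suc i} (s≤s i<n) = subst (_< suc n) (sym (+-suc (at c i) i)) (s≤s (at-bound c i<n))

at-beyond : ∀ {n} (c : Code n) {i} → n ≤ i → at c i ≡ 0
at-beyond ε               _         = refl
at-beyond (x ◂ c) {suc i} (s≤s n≤i) = at-beyond c n≤i

at-injective : ∀ {n} (c d : Code n) → at c ≗ at d → c ≡ d
at-injective ε       ε       eq = refl
at-injective (x ◂ c) (y ◂ d) eq =
  cong₂ _◂_ (Fin.toℕ-injective (eq 0)) (at-injective c d (eq ∘ suc))

code-with : ∀ n (g : ℕ → ℕ) → (∀ i → i < n → g i + i < n) →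
            ∃ λ (c : Code n) → ∀ i → i < n → at c i ≡ g i
code-with zero    g bound = ε , λ _ ()
code-with (suc n) g bound = x ◂ c , at≡
  where
  g₀<n : g 0 < suc n
  g₀<n = subst (_< suc n) (+-identityʳ (g 0)) (bound 0 (s≤s z≤n))
  x = fromℕ< g₀<n
  rest = code-with n (g ∘ suc)
    λ i i<n → s≤s⁻¹ (subst (_< suc n) (+-suc (g (suc i)) i) (bound (suc i) (s≤s i<n)))
  c = proj₁ rest
  at≡ : ∀ i → i < suc n → at (x ◂ c) i ≡ g i
  at≡ zero    _         = Fin.toℕ-fromℕ< g₀<n
  at≡ (suc i) (s≤s i<n) = proj₂ rest i i<n

val-injective : ∀ {n} (c : Code n) {i j} → val c i ≡ val c j → i ≡ j
val-injective ε                       eq = eq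
val-injective (x ◂ c) {zero}  {zero}  eq = refl
val-injective (x ◂ c) {zero}  {suc j} eq = ⊥-elim (punch-≢ (toℕ x) _ (sym eq))
val-injective (x ◂ c) {suc i} {zero}  eq = ⊥-elim (punch-≢ (toℕ x) _ eq)
val-injective (x ◂ c) {suc i} {suc j} eq = cong suc (val-injective c (punch-injective (toℕ x) eq))

val-surjective : ∀ {n} (c : Code n) v → ∃ λ i → val c i ≡ v
val-surjective ε       v = v , refl
val-surjective (x ◂ c) v with <-cmp v (toℕ x)
... | tri≈ _ v≡x _ = 0 , sym v≡x
... | tri< v<x _ _ with i , refl ← val-surjective c v = suc i , punch-< v<x
val-surjective (x ◂ c) (suc v) | tri> _ _ x<v
  with i , refl ← val-surjective c v = suc i , punch-≥ (s≤s⁻¹ x<v)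

val-beyond : ∀ {n} (c : Code n) {i} → n ≤ i → val c i ≡ i
val-beyond ε               _         = refl
val-beyond (x ◂ c) {suc i} (s≤s n≤i) = trans
  (cong (punch (toℕ x)) (val-beyond c n≤i)) (punch-≥ (≤-trans (s≤s⁻¹ (Fin.toℕ<n x)) n≤i))

val-bound : ∀ {n} (c : Code n) {i} → i < n → val c i < n
val-bound (x ◂ c) {zero}  _         = Fin.toℕ<n x
val-bound (x ◂ c) {suc i} (s≤s i<n) = s≤s (≤-trans (punch-≤ (toℕ x) _) (val-bound c i<n))

-- The value at `i` exceeds the code entry by the number of smaller values to the left of `i`, which
-- is between 0 and `i`. This accounts for both this bound and the next one.
at≤val : ∀ {n} (c : Code n) i → at c i ≤ val c i
at≤val ε       i       = z≤n
at≤val (x ◂ c) zero    = ≤-refl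
at≤val (x ◂ c) (suc i) = ≤-trans (at≤val c i) (≤-punch (toℕ x) _)

val≤at+ : ∀ {n} (c : Code n) i → val c i ≤ at c i + i
val≤at+ ε       i       = ≤-refl
val≤at+ (x ◂ c) zero    = m≤m+n (toℕ x) 0
val≤at+ (x ◂ c) (suc i) = ≤-trans (punch-≤ (toℕ x) _)
  (subst (suc (val c i) ≤_) (sym (+-suc (at c i) i)) (s≤s (val≤at+ c i)))

at>0⇒inversion : ∀ {n} (c : Code n) i → 0 < at c i → ∃ λ j → i < j × val c j < val c i
-- Since `x` is positive, the value 0 of the tail is unchanged by `punch` and lies below the head.
at>0⇒inversion (x ◂ c) zero    0<x with j , eq ← val-surjective c 0 =
  suc j , s≤s z≤n , subst (_< toℕ x) (sym (trans (cong (punch (toℕ x)) eq) (punch-< 0<x))) 0<x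
at>0⇒inversion (x ◂ c) (suc i) 0<a with j , i<j , inv ← at>0⇒inversion c i 0<a =
  suc j , s≤s i<j , punch-mono-< (toℕ x) inv

-- From position `n` on the permutation is the identity and exceeds all earlier values, so no
-- inversion ends there.
inversion⇒bound : ∀ {n} (c : Code n) {i j} → i < j → val c j < val c i → j < n
inversion⇒bound {n} c {i} {j} i<j inv with j <? n
... | yes j<n = j<n
... | no  j≮n with n≤j ← ≮⇒≥ j≮n | i <? n
... | yes i<n = ⊥-elim (<⇒≱ inv (≤-trans (<⇒≤ (val-bound c i<n))
  (subst (n ≤_) (sym (val-beyond c n≤j)) n≤j)))
... | no  i≮n = ⊥-elim (<⇒≱ inv (subst₂ _≤_
  (sym (val-beyond c (≮⇒≥ i≮n))) (sym (val-beyond c n≤j)) (<⇒≤ i<j)))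

-- Avoidance of 132 and 3412 in terms of the Lehmer code

Has132 Has213 Has1324 Has3412 : ℕ → (ℕ → ℕ) → Set
Has132 n π = ∃₂ λ i j → ∃ λ k → i < j × j < k × k < n × π i < π k × π k < π j
Has213 n π = ∃₂ λ i j → ∃ λ k → i < j × j < k × k < n × π j < π i × π i < π k
Has1324 n π = ∃₂ λ i j → ∃₂ λ k l →
  i < j × j < k × k < l × l < n × π i < π k × π k < π j × π j < π l
Has3412 n π = ∃₂ λ i j → ∃₂ λ k l →
  i < j × j < k × k < l × l < n × π k < π l × π l < π i × π i < π j

Decreasing : (ℕ → ℕ) → Set
Decreasing λs = ∀ i → λs (suc i) ≤ λs i

-- With f j = λs j + j: no step up of f is followed by a step down.
NoUpDown : (ℕ → ℕ) → Set
NoUpDown λs = ∀ {i j} → i < j → λs i ≡ λs (suc i) → λs j ≤ suc (λs (suc j))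

Decreasing⇒≤ : ∀ {λs} → Decreasing λs → ∀ {i j} → i ≤ j → λs j ≤ λs i
Decreasing⇒≤ {λs} dec {i} {j} i≤j with m≤n⇒m<n∨m≡n i≤j
... | inj₂ refl = ≤-refl
Decreasing⇒≤ dec {i} {suc j} i≤j | inj₁ i<j = ≤-trans (dec j) (Decreasing⇒≤ dec (s≤s⁻¹ i<j))

-- A discrete intermediate value theorem, by scanning down from `j` to the nearest index that
-- satisfies `P`.
crossing : ∀ {P : ℕ → Set} → Decidable P → ∀ {i j} → i ≤ j → P i → ¬ P j →
           ∃ λ u → i ≤ u × u < j × P u × ¬ P (suc u)
crossing P? {i} {j} i≤j Pi ¬Pj with m≤n⇒m<n∨m≡n i≤j
... | inj₂ refl = ⊥-elim (¬Pj Pi)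
crossing P? {i} {suc j} _ Pi ¬Pj | inj₁ i<j with P? j
... | yes Pj = j , s≤s⁻¹ i<j , ≤-refl , Pj , ¬Pj
... | no ¬Pj′ with u , i≤u , u<j , rest ← crossing P? (s≤s⁻¹ i<j) Pi ¬Pj′ =
  u , i≤u , m<n⇒m<1+n u<j , rest

-- The Rothe diagram of a 132-avoider is a Young diagram.
dominant : ∀ {n} (c : Code n) → Decreasing (at c) →
           ∀ {i j} → i < j → val c j < val c i → val c j < at c i
dominant ε       dec i<j inv = ⊥-elim (<-asym i<j inv)
dominant (x ◂ c) dec {zero}  {suc j} _ inv = inv
dominant (x ◂ c) dec {suc i} {suc j} (s≤s i<j) inv
  with below ← dominant c (dec ∘ suc) i<j (punch-cancel-< (toℕ x) inv) =
  subst (_< at c i)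
    (sym (punch-< (<-≤-trans below (Decreasing⇒≤ dec (z≤n {suc i}))))) below

-- After a strict drop all earlier code entries exceed the entry at `suc i`. Punching them leaves
-- that small value alone, so nothing smaller stands to its left.
val-at-drop : ∀ {n} (c : Code n) → Decreasing (at c) →
              ∀ i → at c (suc i) < at c i → val c (suc i) ≡ at c (suc i)
val-at-drop (x ◂ ε)     dec zero    drop = punch-< drop
val-at-drop (x ◂ y ◂ c) dec zero    drop = punch-< drop
val-at-drop (x ◂ c)     dec (suc i) drop = trans
  (cong (punch (toℕ x)) (val-at-drop c (dec ∘ suc) i drop))
  (punch-< (<-≤-trans drop (Decreasing⇒≤ dec (z≤n {suc i}))))

-- By dominance the 2 lies below the code entry of the 3, hence below that of the 1, hence below the
-- 1 itself.
Decreasing⇒¬132 : ∀ {n} (c : Code n) → Decreasing (at c) → ¬ Has132 n (val c)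
Decreasing⇒¬132 c dec (i , j , k , i<j , j<k , _ , πi<πk , πk<πj) = <-asym πi<πk (begin-strict
  val c k <⟨ dominant c dec j<k πk<πj ⟩
  at c j  ≤⟨ Decreasing⇒≤ dec (<⇒≤ i<j) ⟩
  at c i  ≤⟨ at≤val c i ⟩
  val c i ∎)
  where open ≤-Reasoning

Has132-tail : ∀ {n} (x : Fin (suc n)) (c : Code n) → Has132 n (val c) → Has132 (suc n) (val (x ◂ c))
Has132-tail x c (i , j , k , i<j , j<k , k<n , p , q) =
  suc i , suc j , suc k , s≤s i<j , s≤s j<k , s≤s k<n , punch-mono-< (toℕ x) p , punch-mono-< (toℕ x) q

-- If the code rises from `x` to `y`, the value `x` of the tail becomes `x + 1` in the whole
-- permutation and stands after `y + 1`, so `x`, `y + 1`, `x + 1` form a 132.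
¬132⇒Decreasing : ∀ {n} (c : Code n) → ¬ Has132 n (val c) → Decreasing (at c)
¬132⇒Decreasing ε       _     i       = z≤n
¬132⇒Decreasing (x ◂ c) avoid (suc i) = ¬132⇒Decreasing c (avoid ∘ Has132-tail x c) i
¬132⇒Decreasing (x ◂ ε) avoid zero    = z≤n
¬132⇒Decreasing {suc n} (x ◂ y ◂ c) avoid zero with toℕ y ≤? toℕ x
... | yes y≤x = y≤x
... | no  y≰x with ≰⇒> y≰x | val-surjective (y ◂ c) (toℕ x)
... | x<y | zero  , eq = ⊥-elim (<⇒≢ x<y (sym eq))
... | x<y | suc k , eq = ⊥-elim (avoid (0 , 1 , suc (suc k) , s≤s z≤n , s≤s (s≤s z≤n) ,
    inversion⇒bound (x ◂ y ◂ c) (s≤s (s≤s z≤n)) q , p , q))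
  where
  third : val (x ◂ y ◂ c) (suc (suc k)) ≡ suc (toℕ x)
  third = trans (cong (punch (toℕ x)) eq) (punch-≥ ≤-refl)
  second : punch (toℕ x) (toℕ y) ≡ suc (toℕ y)
  second = punch-≥ (<⇒≤ x<y)
  p : toℕ x < val (x ◂ y ◂ c) (suc (suc k))
  p = subst (toℕ x <_) (sym third) ≤-refl
  q : val (x ◂ y ◂ c) (suc (suc k)) < punch (toℕ x) (toℕ y)
  q = subst₂ _<_ (sym third) (sym second) (s≤s x<y)

-- The ascent 34 yields two equal code entries and the 12 yields a drop by at
-- least 2 after them.
NoUpDown⇒¬3412 : ∀ {n} (c : Code n) → Decreasing (at c) → NoUpDown (at c) → ¬ Has3412 n (val c)
NoUpDown⇒¬3412 c dec nud (i , j , k , l , i<j , j<k , k<l , _ , πk<πl , πl<πi , πi<πj) =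
  <⇒≱ k<l (subst (_≤ k) w+1≡l w<k)
  where
  -- Without equal neighbours every step of the code is a strict drop, after which value and code
  -- entry coincide; so the values descend and an ascent is impossible.
  descends : ∀ {j} → i ≤ j → (∀ u → i ≤ u → u < j → at c u ≢ at c (suc u)) → val c j ≤ val c i
  descends {j} i≤j neq with m≤n⇒m<n∨m≡n i≤j
  ... | inj₂ refl = ≤-refl
  descends {suc j} _ neq | inj₁ (s≤s i≤j) = begin
      val c (suc j) ≡⟨ val-at-drop c dec j drop ⟩
      at c (suc j)  ≤⟨ dec j ⟩
      at c j        ≤⟨ at≤val c j ⟩
      val c j       ≤⟨ descends i≤j (λ u i≤u u<j → neq u i≤u (m<n⇒m<1+n u<j)) ⟩
      val c i       ∎
    where
    open ≤-Reasoning
    drop : at c (suc j) < at c j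
    drop = ≤∧≢⇒< (dec j) (neq j i≤j ≤-refl ∘ sym)
  level : ∃ λ u → u < j × at c u ≡ at c (suc u)
  level with anyUpTo? (λ u → at c u ≟ at c (suc u)) j
  ... | yes (u , u<j , eq) = u , u<j , eq
  ... | no none = ⊥-elim (<⇒≱ πi<πj (descends (<⇒≤ i<j) (λ u _ u<j eq → none (u , u<j , eq))))
  πl<λj : val c l < at c j
  πl<λj = dominant c dec (<-trans j<k k<l) (<-trans πl<πi πi<πj)
  -- Dominance puts `val c l` below the entry at `j`, whereas the entry at `k` is at most `val c k`,
  -- which is below `val c l`. So the code passes `val c l` between `j` and `k`.
  fall : ∃ λ w → j ≤ w × w < k × val c l < at c w × ¬ (val c l < at c (suc w))
  fall = crossing (λ w → val c l <? at c w) (<⇒≤ j<k) πl<λj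
    (λ πl<λk → <-asym πk<πl (<-≤-trans πl<λk (at≤val c k)))
  w = proj₁ fall
  j≤w = proj₁ (proj₂ fall)
  w<k = proj₁ (proj₂ (proj₂ fall))
  πl<λw = proj₁ (proj₂ (proj₂ (proj₂ fall)))
  λw₊≤πl : at c (suc w) ≤ val c l
  λw₊≤πl = ≮⇒≥ (proj₂ (proj₂ (proj₂ (proj₂ fall))))
  small : at c w ≤ suc (at c (suc w))
  small = nud (<-≤-trans (proj₁ (proj₂ level)) j≤w) (proj₂ (proj₂ level))
  -- A drop by at most 1 lands exactly on `val c l`, and after a drop the entry is the value. So `l`
  -- would be `suc w`, which is at most `k`.
  w+1≡l : suc w ≡ l
  w+1≡l = val-injective c (trans
    (val-at-drop c dec w (≤-<-trans λw₊≤πl πl<λw))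
    (≤-antisym λw₊≤πl (s≤s⁻¹ (≤-trans πl<λw small))))

-- Equal entries at `i` and `suc i` give an ascent, the 34. A drop by at least 2 after `j` puts the
-- value `v = at c (suc j)` at `suc j`, the 1. The 2 is the value `v + 1`: it stands further right,
-- since all values up to position `j` are at least `at c j`.
¬3412⇒NoUpDown : ∀ {n} (c : Code n) → Decreasing (at c) → ¬ Has3412 n (val c) → NoUpDown (at c)
¬3412⇒NoUpDown {n} c dec avoid {i} {j} i<j level with at c j ≤? suc (at c (suc j))
... | yes small = small
... | no  large with v<λj ← ≰⇒> large | l , πl≡ ← val-surjective c (suc (at c (suc j))) =
  ⊥-elim (avoid (i , suc i , suc j , l , ≤-refl , s≤s i<j , j+1<l ,
    inversion⇒bound c (<-trans i<j (<-trans ≤-refl j+1<l)) πl<πi , πj₊<πl , πl<πi , ascent))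
  where
  πj₊≡ : val c (suc j) ≡ at c (suc j)
  πj₊≡ = val-at-drop c dec j (<-trans ≤-refl v<λj)
  πj₊<πl : val c (suc j) < val c l
  πj₊<πl = subst₂ _<_ (sym πj₊≡) (sym πl≡) ≤-refl
  λj≤πu : ∀ {u} → u ≤ j → at c j ≤ val c u
  λj≤πu u≤j = ≤-trans (Decreasing⇒≤ dec u≤j) (at≤val c _)
  πl<πi : val c l < val c i
  πl<πi = subst (_< val c i) (sym πl≡) (<-≤-trans v<λj (λj≤πu (<⇒≤ i<j)))
  j+1<l : suc j < l
  j+1<l with <-cmp l (suc j)
  ... | tri< (s≤s l≤j) _ _ = ⊥-elim (<⇒≱ v<λj (subst (at c j ≤_) πl≡ (λj≤πu l≤j)))
  ... | tri≈ _ refl _ = ⊥-elim (<-irrefl refl πj₊<πl)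
  ... | tri> _ _ j+1<l = j+1<l
  ascent : val c i < val c (suc i)
  ascent with <-cmp (val c i) (val c (suc i))
  ... | tri< p _ _ = p
  ... | tri≈ _ p _ = ⊥-elim (<⇒≢ (≤-refl {suc i}) (val-injective c p))
  ... | tri> _ _ p = ⊥-elim (<⇒≱ (subst (val c (suc i) <_) level (dominant c dec ≤-refl p)) (at≤val c (suc i)))

-- Convex penny arrangements

Card-words : ∀ {A : Set} {xs : List A} → Unique xs → (∀ x → x ∈ xs) →
             ∀ n → Card {Vec A n} U (length (words xs n))
Card-words {xs = xs} xs! all n = card (words xs n) (words! n) (λ _ → _) (λ {v} _ → complete v) refl
  where
  words! : ∀ n → Unique (words xs n)
  words! zero    = [] ∷ []
  words! (suc n) = Unique.cartesianProductWith⁺ _∷_ ∷-injective xs! (words! n)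
  complete : ∀ {n} (v : Vec _ n) → v ∈ words xs n
  complete []      = here refl
  complete (x ∷ v) = ∈-cartesianProductWith⁺ _∷_ (all x) (complete v)

Card-configs : ∀ r → Card {Config r} U (length (configs r))
Card-configs r = card (configs r) (configs! r) (λ _ → _) (λ {c} _ → complete c) refl
  where
  bools = true List.∷ false List.∷ List.[]
  bools! : Unique bools
  bools! = ((λ ()) ∷ []) ∷ [] ∷ []
  subsets : ∀ n → Card {Subset n} U _
  subsets = Card-words bools! λ { true → here refl ; false → there (here refl) }
  ∷-inj : ∀ {r} {s t : Subset (suc r)} {c d : Config r} → s Config.∷ c ≡ t ∷ d → s ≡ t × c ≡ d
  ∷-inj refl = refl , refl
  configs! : ∀ r → Unique (configs r)
  configs! zero    = [] ∷ []
  configs! (suc r) = Unique.cartesianProductWith⁺ _∷_ ∷-inj (Card.unique (subsets (suc r))) (configs! r)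
  complete : ∀ {r} (c : Config r) → c ∈ configs r
  complete []      = here refl
  complete (s ∷ c) = ∈-cartesianProductWith⁺ _∷_ (Card.complete (subsets _) _) (complete c)

-- Missing pennies and rows as sublevel sets

Σ< : ℕ → (ℕ → ℕ) → ℕ
Σ< zero    g = 0
Σ< (suc n) g = g 0 + Σ< n (g ∘ suc)

weight≡Σ< : ∀ {n} (c : Code n) → weight c ≡ Σ< n (at c)
weight≡Σ< ε       = refl
weight≡Σ< (x ◂ c) = cong (toℕ x +_) (weight≡Σ< c)

Σ<-cong : ∀ n {g h} → (∀ i → i < n → g i ≡ h i) → Σ< n g ≡ Σ< n h
Σ<-cong zero    eq = refl
Σ<-cong (suc n) eq = cong₂ _+_ (eq 0 (s≤s z≤n)) (Σ<-cong n λ i i<n → eq (suc i) (s≤s i<n))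

Σ<-+ : ∀ n g h → Σ< n (λ i → g i + h i) ≡ Σ< n g + Σ< n h
Σ<-+ zero    g h = refl
Σ<-+ (suc n) g h = trans (cong (g 0 + h 0 +_) (Σ<-+ n (g ∘ suc) (h ∘ suc)))
  (interchange +-commutativeSemigroup (g 0) (h 0) _ _)

Σ<-extend : ∀ n g → g n ≡ 0 → Σ< (suc n) g ≡ Σ< n g
Σ<-extend zero    g eq = trans (+-identityʳ (g 0)) eq
Σ<-extend (suc n) g eq = cong (g 0 +_) (Σ<-extend n (g ∘ suc) eq)

row : (ℕ → ℕ) → ∀ m → Subset m
row f m = tabulate λ j → does (f (toℕ j) <? m)

build : (ℕ → ℕ) → ∀ r → Config r
build f zero    = []
build f (suc r) = row f (suc r) ∷ build f r

∈-row⁺ : ∀ f {m} {j : Fin m} → f (toℕ j) < m → j ∈ₛ row f m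
∈-row⁺ f {m} {j} fj<m = lookup⇒[]= j (row f m) (trans (lookup∘tabulate _ j) (dec-true (_ <? _) fj<m))

∈-row⁻ : ∀ f {m} {j : Fin m} → j ∈ₛ row f m → f (toℕ j) < m
∈-row⁻ f {m} {j} j∈ = decidable-stable (f (toℕ j) <? m) λ fj≮m →
  case trans (sym (dec-false (f (toℕ j) <? m) fj≮m)) present of λ ()
  where
  present : does (f (toℕ j) <? m) ≡ true
  present = trans (sym (lookup∘tabulate _ j)) ([]=⇒lookup j∈)

-- Positions beyond the end of the row are not counted as missing, so `miss` only sees the rows that
-- have a position `j`.
gap : ∀ {n} → Subset n → ℕ → ℕ
gap []          _       = 0
gap (true  ∷ s) zero    = 0
gap (false ∷ s) zero    = 1
gap (_     ∷ s) (suc j) = gap s j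

miss : ∀ {r} → Config r → ℕ → ℕ
miss []      j = 0
miss (s ∷ c) j = gap s j + miss c j

gap-∈ : ∀ {n} {s : Subset n} {j} → j ∈ₛ s → gap s (toℕ j) ≡ 0
gap-∈ {s = true  ∷ s} {Fin.zero}  _            = refl
gap-∈ {s = true  ∷ s} {Fin.suc j} (Vec.there p) = gap-∈ p
gap-∈ {s = false ∷ s} {Fin.suc j} (Vec.there p) = gap-∈ p

gap-∉ : ∀ {n} {s : Subset n} {j} → ¬ j ∈ₛ s → gap s (toℕ j) ≡ 1
gap-∉ {s = true  ∷ s} {Fin.zero}  p = ⊥-elim (p Vec.here)
gap-∉ {s = false ∷ s} {Fin.zero}  p = refl
gap-∉ {s = true  ∷ s} {Fin.suc j} p = gap-∉ (p ∘ Vec.there)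
gap-∉ {s = false ∷ s} {Fin.suc j} p = gap-∉ (p ∘ Vec.there)

gap-beyond : ∀ {n} (s : Subset n) {j} → n ≤ j → gap s j ≡ 0
gap-beyond []          _         = refl
gap-beyond (true  ∷ s) (s≤s n≤j) = gap-beyond s n≤j
gap-beyond (false ∷ s) (s≤s n≤j) = gap-beyond s n≤j

gap≤1 : ∀ {n} (s : Subset n) j → gap s j ≤ 1
gap≤1 []          j       = z≤n
gap≤1 (true  ∷ s) zero    = z≤n
gap≤1 (false ∷ s) zero    = ≤-refl
gap≤1 (true  ∷ s) (suc j) = gap≤1 s j
gap≤1 (false ∷ s) (suc j) = gap≤1 s j

miss-beyond : ∀ {r} (c : Config r) {j} → r ≤ j → miss c j ≡ 0
miss-beyond []      _   = refl
miss-beyond (s ∷ c) r≤j = cong₂ _+_ (gap-beyond s r≤j) (miss-beyond c (<⇒≤ r≤j))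

-- Only the `r ∸ j` rows with more than `j` positions can miss position `j`.
miss-bound : ∀ {r} (c : Config r) {j} → j ≤ r → miss c j + j ≤ r
miss-bound {r} c j≤r with m≤n⇒m<n∨m≡n j≤r
... | inj₂ refl = ≤-reflexive (cong (_+ r) (miss-beyond c ≤-refl))
miss-bound {suc r} (s ∷ c) {j} _ | inj₁ (s≤s j≤r) = subst (_≤ suc r) (sym (+-assoc (gap s j) (miss c j) j))
  (+-mono-≤ (gap≤1 s j) (miss-bound c j≤r))

triangle : ℕ → ℕ
triangle zero    = 0
triangle (suc r) = suc r + triangle r

triangle≡ : ∀ r → r * (r + 1) / 2 ≡ triangle r
triangle≡ r = trans (cong (_/ 2) (sym (double r))) (m*n/n≡m (triangle r) 2)
  where
  step : ∀ r → suc r * 2 + r * (r + 1) ≡ suc r * (suc r + 1)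
  step = solve-∀
  double : ∀ r → triangle r * 2 ≡ r * (r + 1)
  double zero    = refl
  double (suc r) = trans (*-distribʳ-+ 2 (suc r) (triangle r)) (trans (cong (suc r * 2 +_) (double r)) (step r))

∣_∣+gaps : ∀ {n} (s : Subset n) → ∣ s ∣ + Σ< n (gap s) ≡ n
∣ []        ∣+gaps = refl
∣ true  ∷ s ∣+gaps = cong suc ∣ s ∣+gaps
∣ false ∷ s ∣+gaps = trans (+-suc ∣ s ∣ _) (cong suc ∣ s ∣+gaps)

pennies+missing : ∀ {r} (c : Config r) → pennies c + Σ< r (miss c) ≡ triangle r
pennies+missing []              = refl
pennies+missing {suc r} (s ∷ c) = begin
  ∣ s ∣ + pennies c + Σ< (suc r) (λ j → gap s j + miss c j)
    ≡⟨ cong (∣ s ∣ + pennies c +_) (Σ<-+ (suc r) (gap s) (miss c)) ⟩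
  ∣ s ∣ + pennies c + (Σ< (suc r) (gap s) + Σ< (suc r) (miss c))
    ≡⟨ cong (λ m → ∣ s ∣ + pennies c + (Σ< (suc r) (gap s) + m)) (Σ<-extend r (miss c) (miss-beyond c ≤-refl)) ⟩
  ∣ s ∣ + pennies c + (Σ< (suc r) (gap s) + Σ< r (miss c))
    ≡⟨ interchange +-commutativeSemigroup ∣ s ∣ (pennies c) _ _ ⟩
  (∣ s ∣ + Σ< (suc r) (gap s)) + (pennies c + Σ< r (miss c))
    ≡⟨ cong₂ _+_ ∣ s ∣+gaps (pennies+missing c) ⟩
  suc r + triangle r ∎
  where
  open ≡-Reasoning

-- Position `j` is missing from exactly those rows whose number of positions is greater than `j` and
-- at most `f j ⊓ m`.
miss-build : ∀ {f} → (∀ j → j ≤ f j) → ∀ m {j} → j ≤ m → miss (build f m) j + j ≡ f j ⊓ m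
miss-build {f} j≤f m {j} j≤m with m≤n⇒m<n∨m≡n j≤m
... | inj₂ refl = trans (cong (_+ m) (miss-beyond (build f m) ≤-refl)) (sym (m≥n⇒m⊓n≡n (j≤f m)))
miss-build {f} j≤f (suc m) {j} _ | inj₁ j<m@(s≤s j≤m) = helper
  where
  toℕ≡ = Fin.toℕ-fromℕ< j<m
  helper : gap (row f (suc m)) j + miss (build f m) j + j ≡ f j ⊓ suc m
  helper with f j <? suc m
  ... | yes fj<m = begin
    gap (row f (suc m)) j + miss (build f m) j + j ≡⟨ cong (λ g → g + miss (build f m) j + j) gap≡ ⟩
    miss (build f m) j + j ≡⟨ miss-build j≤f m j≤m ⟩
    f j ⊓ m     ≡⟨ m≤n⇒m⊓n≡m (s≤s⁻¹ fj<m) ⟩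
    f j         ≡⟨ m≤n⇒m⊓n≡m (<⇒≤ fj<m) ⟨
    f j ⊓ suc m ∎
    where
    open ≡-Reasoning
    gap≡ : gap (row f (suc m)) j ≡ 0
    gap≡ = subst (λ j → gap (row f (suc m)) j ≡ 0) toℕ≡
      (gap-∈ (∈-row⁺ f (subst (λ j → f j < suc m) (sym toℕ≡) fj<m)))
  ... | no fj≮m = begin
    gap (row f (suc m)) j + miss (build f m) j + j ≡⟨ cong (λ g → g + miss (build f m) j + j) gap≡ ⟩
    suc (miss (build f m) j + j) ≡⟨ cong suc (miss-build j≤f m j≤m) ⟩
    suc (f j ⊓ m) ≡⟨ cong suc (m≥n⇒m⊓n≡n (<⇒≤ (≮⇒≥ fj≮m))) ⟩
    suc m         ≡⟨ m≥n⇒m⊓n≡n (≮⇒≥ fj≮m) ⟨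
    f j ⊓ suc m   ∎
    where
    open ≡-Reasoning
    gap≡ : gap (row f (suc m)) j ≡ 1
    gap≡ = subst (λ j → gap (row f (suc m)) j ≡ 1) toℕ≡
      (gap-∉ (fj≮m ∘ subst (λ j → f j < suc m) toℕ≡ ∘ ∈-row⁻ f))

-- Only comparisons with some `m ≤ r` matter, so the functions may differ from `r` upwards. This
-- happens in `build-level`, where a position absent from the bottom row has level `suc r` in the
-- whole configuration and `r` in the rows above.
build-cong : ∀ {f g} r → (∀ {j m} → j < r → m ≤ r → f j < m → g j < m) →
                         (∀ {j m} → j < r → m ≤ r → g j < m → f j < m) → build f r ≡ build g r
build-cong zero    f⇒g g⇒f = refl
build-cong {f} {g} (suc r) f⇒g g⇒f = cong₂ _∷_
  (tabulate-cong λ j → does-cong (f⇒g (Fin.toℕ<n j) ≤-refl) (g⇒f (Fin.toℕ<n j) ≤-refl))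
  (build-cong r (λ j<r m≤r → f⇒g (m<n⇒m<1+n j<r) (m≤n⇒m≤1+n m≤r))
                (λ j<r m≤r → g⇒f (m<n⇒m<1+n j<r) (m≤n⇒m≤1+n m≤r)))
  where
  does-cong : ∀ {a b} → (a < suc r → b < suc r) → (b < suc r → a < suc r) →
              does (a <? suc r) ≡ does (b <? suc r)
  does-cong {a} {b} to from with b <? suc r
  ... | yes p = trans (dec-true (a <? suc r) (from p)) (sym (dec-true (b <? suc r) p))
  ... | no ¬p = trans (dec-false (a <? suc r) (¬p ∘ to)) (sym (dec-false (b <? suc r) ¬p))

-- The candidate for the function whose sublevel sets are the rows.
level : ∀ {r} → Config r → ℕ → ℕ
level c j = miss c j + j

-- In a supported configuration every row above an empty position misses
-- that position too.
level-∉ : ∀ {r} (s : Subset (suc r)) (c : Config r) → Supported (s ∷ c) →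
          ∀ {j} → ¬ j ∈ₛ s → level c (toℕ j) ≡ r
level-∉ s [] _ {Fin.zero} _ = refl
level-∉ {suc r} s (t ∷ c) (rests , sup) {j} j∉s with m≤n⇒m<n∨m≡n (s≤s⁻¹ (Fin.toℕ<n j))
... | inj₂ j≡r = trans (cong (level (t ∷ c)) j≡r) (cong (_+ suc r) (miss-beyond (t ∷ c) ≤-refl))
... | inj₁ j<r = begin
    level (t ∷ c) (toℕ j)  ≡⟨ cong (level (t ∷ c)) (sym toℕ≡) ⟩
    gap t (toℕ j′) + miss c (toℕ j′) + toℕ j′ ≡⟨ cong (λ g → g + miss c (toℕ j′) + toℕ j′) (gap-∉ j′∉t) ⟩
    suc (level c (toℕ j′)) ≡⟨ cong suc (level-∉ t c sup j′∉t) ⟩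
    suc r ∎
  where
  open ≡-Reasoning
  j′ = fromℕ< j<r
  toℕ≡ : toℕ j′ ≡ toℕ j
  toℕ≡ = Fin.toℕ-fromℕ< j<r
  j′∉t : ¬ j′ ∈ₛ t
  j′∉t j′∈t = j∉s (subst (_∈ₛ s) (Fin.toℕ-injective (trans (Fin.toℕ-inject₁ j′) toℕ≡)) (proj₁ (rests j′ j′∈t)))

tail-Supported : ∀ {r} (s : Subset (suc r)) (c : Config r) → Supported (s ∷ c) → Supported c
tail-Supported s []      _         = _
tail-Supported s (t ∷ c) (_ , sup) = sup

-- By support, the rows that contain `j` are the lowest ones, so the number of rows that miss `j`
-- determines which ones do.
build-level : ∀ {r} (c : Config r) → Supported c → build (level c) r ≡ c
build-level []      _   = refl
build-level {suc r} (s ∷ c) sup = cong₂ _∷_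
  (trans (tabulate-cong bit) (tabulate∘lookup s))
  (trans (build-cong r to from) (build-level c (tail-Supported s c sup)))
  where
  present : ∀ {j : Fin (suc r)} → j ∈ₛ s → level (s ∷ c) (toℕ j) ≡ level c (toℕ j)
  present {j} j∈s = cong (λ g → g + miss c (toℕ j) + toℕ j) (gap-∈ j∈s)
  absent : ∀ {j : Fin (suc r)} → ¬ j ∈ₛ s → level (s ∷ c) (toℕ j) ≡ suc r
  absent {j} j∉s = trans (cong (λ g → g + miss c (toℕ j) + toℕ j) (gap-∉ j∉s)) (cong suc (level-∉ s c sup j∉s))
  bit : ∀ j → does (level (s ∷ c) (toℕ j) <? suc r) ≡ lookup s j
  bit j with j ∈ₛ? s
  ... | yes j∈s = trans
    (dec-true (_ <? _) (subst (_< suc r) (sym (present j∈s)) (s≤s (miss-bound c (s≤s⁻¹ (Fin.toℕ<n j))))))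
    (sym ([]=⇒lookup j∈s))
  ... | no j∉s = trans
    (dec-false (_ <? _) (<-irrefl (absent j∉s)))
    (sym (off (lookup s j) refl))
    where
    off : ∀ b → lookup s j ≡ b → b ≡ false
    off true  eq = ⊥-elim (j∉s (lookup⇒[]= j s eq))
    off false eq = refl
  to : ∀ {j m} → j < r → m ≤ r → level (s ∷ c) j < m → level c j < m
  to {j} _ _ = ≤-<-trans (+-monoˡ-≤ j (m≤n+m (miss c j) (gap s j)))
  from : ∀ {j m} → j < r → m ≤ r → level c j < m → level (s ∷ c) j < m
  from {j} {m} j<r m≤r lt with fromℕ< {j} (m<n⇒m<1+n j<r) | Fin.toℕ-fromℕ< {j} (m<n⇒m<1+n j<r)
  ... | j′ | refl with j′ ∈ₛ? s
  ... | yes j∈s = subst (_< m) (sym (present j∈s)) lt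
  ... | no j∉s = ⊥-elim (<⇒≱ (<-≤-trans lt m≤r) (≤-reflexive (sym (level-∉ s c sup j∉s))))

Supported-build⁺ : ∀ {f} → (∀ j → f (suc j) ≤ suc (f j)) → ∀ r → Supported (build f r)
Supported-build⁺     step zero          = _
Supported-build⁺     step (suc zero)    = _
Supported-build⁺ {f} step (suc (suc r)) = rests , Supported-build⁺ step (suc r)
  where
  rests : RestsOn (row f (suc r)) (row f (suc (suc r)))
  rests j j∈ with fj<r ← ∈-row⁻ f j∈ =
    ∈-row⁺ f (subst (λ j → f j < suc (suc r)) (sym (Fin.toℕ-inject₁ j)) (m<n⇒m<1+n fj<r)) ,
    ∈-row⁺ f (≤-<-trans (step (toℕ j)) (s≤s fj<r))

-- The rows with `m` and `suc m` positions both occur, and `j ≤ f j < m` makes `j` an occupied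
-- position of the upper one; its right support is the claim.
Supported-build⁻ : ∀ {f} → (∀ j → j ≤ f j) → ∀ r → Supported (build f r) →
                   ∀ {m j} → m < r → f j < m → f (suc j) < suc m
Supported-build⁻ j≤f (suc zero)    _ {zero}  _ ()
Supported-build⁻     j≤f (suc zero)    _ {suc m} (s≤s ())
Supported-build⁻ {f} j≤f (suc (suc r)) (rests , sup) {m} {j} (s≤s m<r) fj<m =
  [ (λ m<r′ → Supported-build⁻ j≤f (suc r) sup m<r′ fj<m) , lowest ]′ (m≤n⇒m<n∨m≡n m<r)
  where
  lowest : m ≡ suc r → f (suc j) < suc m
  lowest refl with fromℕ< {j} (≤-<-trans (j≤f j) fj<m) | Fin.toℕ-fromℕ< {j} (≤-<-trans (j≤f j) fj<m)
  ... | j′ | refl = ∈-row⁻ f (proj₂ (rests j′ (∈-row⁺ f fj<m)))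

-- Convexity as the absence of peaks

QuasiConvex : ℕ → (ℕ → ℕ) → Set
QuasiConvex r f = ∀ {i j l m} → i ≤ j → j ≤ l → m ≤ r → f i < m → f l < m → f j < m

Convex-build⁺ : ∀ {f} r → QuasiConvex r f → Convex (build f r)
Convex-build⁺     zero    qc = _
Convex-build⁺ {f} (suc r) qc =
  (λ i j l i≤j j≤l i∈ l∈ → ∈-row⁺ f (qc i≤j j≤l ≤-refl (∈-row⁻ f i∈) (∈-row⁻ f l∈))) ,
  Convex-build⁺ r λ i≤j j≤l m≤r → qc i≤j j≤l (m≤n⇒m≤1+n m≤r)

Convex-build⁻ : ∀ {f} → (∀ j → j ≤ f j) → ∀ r → Convex (build f r) → QuasiConvex r f
Convex-build⁻ j≤f zero _ i≤j j≤l z≤n ()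
Convex-build⁻ {f} j≤f (suc r) (int , cvx) {i} {j} {l} i≤j j≤l m≤r fi<m fl<m with m≤n⇒m<n∨m≡n m≤r
... | inj₁ m<r = Convex-build⁻ j≤f r cvx i≤j j≤l (s≤s⁻¹ m<r) fi<m fl<m
... | inj₂ refl
  with l<m ← ≤-<-trans (j≤f l) fl<m
  with j<m ← ≤-<-trans j≤l l<m
  with i<m ← ≤-<-trans i≤j j<m
  with fromℕ< {i} i<m | Fin.toℕ-fromℕ< {i} i<m
     | fromℕ< {j} j<m | Fin.toℕ-fromℕ< {j} j<m
     | fromℕ< {l} l<m | Fin.toℕ-fromℕ< {l} l<m
... | i′ | refl | j′ | refl | l′ | refl =
  ∈-row⁻ f (int i′ j′ l′ i≤j j≤l (∈-row⁺ f fi<m) (∈-row⁺ f fl<m))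

-- A violation leaves the sublevel set at some `u < j` and re-enters it at some `w ≥ j`. As `g`
-- decreases, leaving forces `g u ≡ g (suc u)`, and re-entering forces `g` to drop by at least 2.
NoUpDown⇒QuasiConvex : ∀ {g} r → Decreasing g → NoUpDown g → QuasiConvex r (λ j → g j + j)
NoUpDown⇒QuasiConvex {g} r dec nud {i} {j} {l} {m} i≤j j≤l _ fi<m fl<m with g j + j <? m
... | yes fj<m = fj<m
... | no  fj≮m
  with u , _ , u<j , fu<m , fu₊≮m ← crossing (λ u → g u + u <? m) i≤j fi<m fj≮m
  with w , j≤w , _ , fw≮m , ¬fw₊≮m ← crossing (λ u → ¬? (g u + u <? m)) j≤l fj≮m (λ ¬p → ¬p fl<m) =
  ⊥-elim (<⇒≱ (+-cancelʳ-< w _ _ drop) (nud (<-≤-trans u<j j≤w) same))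
  where
  rise : g u ≤ g (suc u)
  rise = +-cancelʳ-≤ u _ _ (s≤s⁻¹ (subst (g u + u <_) (+-suc (g (suc u)) u) (<-≤-trans fu<m (≮⇒≥ fu₊≮m))))
  same : g u ≡ g (suc u)
  same = ≤-antisym rise (dec u)
  drop : suc (g (suc w)) + w < g w + w
  drop = subst (_< g w + w) (+-suc (g (suc w)) w)
    (<-≤-trans (decidable-stable (_ <? _) ¬fw₊≮m) (≮⇒≥ fw≮m))

-- An up step at `i` followed by a down step at `j` creates a peak. The bound on `g j + j` keeps the
-- threshold that exposes it within the range up to `r`.
QuasiConvex⇒NoUpDown : ∀ {g r} → Decreasing g → (∀ {j} → 0 < g j → g j + j ≤ r) →
                       QuasiConvex r (λ j → g j + j) → NoUpDown g
QuasiConvex⇒NoUpDown {g} {r} dec bound qc {i} {j} i<j same with g j ≤? suc (g (suc j))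
... | yes small = small
... | no  large = ⊥-elim contra
  where
  f : ℕ → ℕ
  f j = g j + j
  gj>0 : 0 < g j
  gj>0 = <-trans (s≤s z≤n) (≰⇒> large)
  down : f (suc j) < f j
  down = subst (_< f j) (sym (+-suc (g (suc j)) j)) (+-monoˡ-< j (≰⇒> large))
  up : f i < f (suc i)
  up = subst (f i <_) (trans (cong (λ x → suc (x + i)) same) (sym (+-suc (g (suc i)) i))) ≤-refl
  -- The threshold is the larger side of the peak: `f j` on `i`, `j`, `suc j` if `f i < f j`, and
  -- otherwise `f (suc i)` on `i`, `suc i`, `suc j`.
  contra : ⊥
  contra with f i <? f j
  ... | yes fi<fj = <-irrefl refl (qc (<⇒≤ i<j) (n≤1+n j) (bound gj>0) fi<fj down)
  ... | no  fi≮fj = <-irrefl refl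
    (qc (n≤1+n i) i<j (bound (<-≤-trans gj>0 (Decreasing⇒≤ dec i<j))) up (≤-<-trans (≮⇒≥ fi≮fj) up))

-- The bijection between codes and convex penny arrangements

GoodCode : ∀ r → ℕ → Code r → Set
GoodCode r k c = weight c ≡ k × Decreasing (at c) × NoUpDown (at c)

toConfig : ∀ {r} → Code r → Config r
toConfig {r} c = build (λ j → at c j + j) r

toConfig-miss : ∀ {r} (c : Code r) {j} → j < r → miss (toConfig c) j ≡ at c j
toConfig-miss {r} c {j} j<r = +-cancelʳ-≡ j _ _ (trans
  (miss-build (λ j → m≤n+m j (at c j)) r (<⇒≤ j<r))
  (m≤n⇒m⊓n≡m (<⇒≤ (at-bound c j<r))))

toConfig-missing : ∀ {r} (c : Code r) → Σ< r (miss (toConfig c)) ≡ weight c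
toConfig-missing {r} c = trans (Σ<-cong r λ _ → toConfig-miss c) (sym (weight≡Σ< c))

toConfig-injective : ∀ {r} (c d : Code r) → toConfig c ≡ toConfig d → c ≡ d
toConfig-injective {r} c d eq = at-injective c d same
  where
  same : at c ≗ at d
  same j with j <? r
  ... | yes j<r = trans (sym (toConfig-miss c j<r)) (trans (cong (λ e → miss e j) eq) (toConfig-miss d j<r))
  ... | no  j≮r = trans (at-beyond c (≮⇒≥ j≮r)) (sym (at-beyond d (≮⇒≥ j≮r)))

toConfig-BottomFull : ∀ {r} (c : Code r) → BottomFull (toConfig c)
toConfig-BottomFull ε       = _
toConfig-BottomFull {suc r} c@(_ ◂ _) = trans
  (tabulate-cong λ j → trans (dec-true (_ <? _) (at-bound c (Fin.toℕ<n j))) (sym ([]=⇒lookup (∈⊤ {x = j}))))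
  (tabulate∘lookup (⊤ {suc r}))

level-bound : ∀ {r} (c : Config r) → BottomFull c → ∀ j → j < r → level c j < r
level-bound {suc r} (s ∷ c) refl j j<r with fromℕ< {j} j<r | Fin.toℕ-fromℕ< {j} j<r
... | j′ | refl = subst (_< suc r) (sym (cong (λ g → g + miss c j + j) (gap-∈ {s = s} {j = j′} ∈⊤)))
  (s≤s (miss-bound c (s≤s⁻¹ j<r)))

fromConfig : ∀ {r} (e : Config r) → IsPennyArrangement e → Convex e →
             ∃ λ (c : Code r) → Decreasing (at c) × NoUpDown (at c) × toConfig c ≡ e
fromConfig {r} e (full , sup) cvx with c , at≡ ← code-with r (miss e) (level-bound e full) =
  c , dec , QuasiConvex⇒NoUpDown dec bound convex , built
  where
  f : ℕ → ℕ
  f j = at c j + j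
  j≤f : ∀ j → j ≤ f j
  j≤f j = m≤n+m j (at c j)
  built : build f r ≡ e
  built = trans (build-cong r (λ {j} {m} j<r _ → subst (_< m) (cong (_+ j) (at≡ j j<r)))
                              (λ {j} {m} j<r _ → subst (_< m) (cong (_+ j) (sym (at≡ j j<r)))))
                (build-level e sup)
  convex : QuasiConvex r f
  convex = Convex-build⁻ j≤f r (subst Convex (sym built) cvx)
  bound : ∀ {j} → 0 < at c j → f j ≤ r
  bound {j} pos with j <? r
  ... | yes j<r = <⇒≤ (at-bound c j<r)
  ... | no  j≮r = ⊥-elim (<⇒≢ pos (sym (at-beyond c (≮⇒≥ j≮r))))
  dec : Decreasing (at c)
  dec j with suc j <? r
  ... | no  j+1≮r = subst (_≤ at c j) (sym (at-beyond c (≮⇒≥ j+1≮r))) z≤n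
  -- Support bounds `f (suc j)` through the rows with `suc (f j)` and `suc (suc (f j))` positions if
  -- both exist. Otherwise `r ≤ suc (f j)`, and the full bottom row already gives `f (suc j) < r`.
  ... | yes j+1<r with suc (f j) <? r
  ... | yes fj+1<r = +-cancelʳ-≤ j _ _ (s≤s⁻¹ (subst (_≤ suc (f j)) (+-suc (at c (suc j)) j)
    (s≤s⁻¹ (Supported-build⁻ j≤f r (subst Supported (sym built) sup) fj+1<r ≤-refl))))
  ... | no  fj+1≮r = +-cancelʳ-≤ j _ _ (<⇒≤ (s≤s⁻¹ (≤-trans
    (subst (_< r) (+-suc (at c (suc j)) j) (at-bound c j+1<r)) (≮⇒≥ fj+1≮r))))

Card-penny : ∀ r k →
  Card (IsConvexPennyArrangement (triangle r ∸ k)) (numConvex (triangle r ∸ k) r)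
Card-penny r k = Card-cong proj₂ (_ ,_) (Card-filter (isConvexPennyArrangement? (triangle r ∸ k)) (Card-configs r))

-- The condition on `k` keeps `triangle r ∸ k` from truncating, so an arrangement of that size
-- misses exactly `k` pennies.
Card-GoodCode : ∀ {r k n} → k ≤ triangle r →
  Card (IsConvexPennyArrangement {r} (triangle r ∸ k)) n → Card (GoodCode r k) n
Card-GoodCode {r} {k} k≤△ = Card-bij⁻ toConfig (λ {c} → sound {c}) (λ _ _ → toConfig-injective _ _) surj
  where
  sound : ∀ {c} → GoodCode r k c → IsConvexPennyArrangement (triangle r ∸ k) (toConfig c)
  sound {c} (refl , dec , nud) =
    trans (sym (m+n∸n≡m (pennies (toConfig c)) (weight c)))
      (cong (_∸ weight c) (trans (cong (pennies (toConfig c) +_) (sym (toConfig-missing c)))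
        (pennies+missing (toConfig c)))) ,
    (toConfig-BottomFull c , Supported-build⁺ step r) ,
    Convex-build⁺ r (NoUpDown⇒QuasiConvex r dec nud)
    where
    step : ∀ j → at c (suc j) + suc j ≤ suc (at c j + j)
    step j = subst (_≤ suc (at c j + j)) (sym (+-suc (at c (suc j)) j)) (s≤s (+-monoˡ-≤ j (dec j)))
  surj : ∀ {e} → IsConvexPennyArrangement (triangle r ∸ k) e → ∃ λ c → GoodCode r k c × toConfig c ≡ e
  surj {e} (N , penny , cvx) with c , dec , nud , refl ← fromConfig e penny cvx =
    c , (+-cancelˡ-≡ (triangle r ∸ k) _ _ weigh , dec , nud) , refl
    where
    weigh : (triangle r ∸ k) + weight c ≡ (triangle r ∸ k) + k
    weigh = trans (cong₂ _+_ (sym N) (sym (toConfig-missing c)))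
      (trans (pennies+missing (toConfig c)) (sym (m∸n+n≡m k≤△)))

-- Stability of the counts as the bottom row grows

Σ<-lower : ∀ {g} → Decreasing g → ∀ {j n} → j < n → 0 < g j → g j + j ≤ Σ< n g
Σ<-lower {g} dec {zero}  {suc n} _         pos = subst (_≤ g 0 + Σ< n (g ∘ suc)) (sym (+-identityʳ (g 0)))
  (m≤m+n (g 0) _)
-- The entry at 0 is at least the positive entry at `suc j`, so it pays for the shift of the index
-- by one.
Σ<-lower {g} dec {suc j} {suc n} (s≤s j<n) pos = subst (_≤ g 0 + Σ< n (g ∘ suc)) (sym (+-suc (g (suc j)) j))
  (+-mono-≤ (<-≤-trans pos (Decreasing⇒≤ dec z≤n)) (Σ<-lower (dec ∘ suc) j<n pos))

extend : ∀ {n} → Code n → Code (suc n)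
extend ε       = Fin.zero ◂ ε
extend (x ◂ c) = inject₁ x ◂ extend c

at-extend : ∀ {n} (c : Code n) → at (extend c) ≗ at c
at-extend ε       zero    = refl
at-extend ε       (suc i) = refl
at-extend (x ◂ c) zero    = Fin.toℕ-inject₁ x
at-extend (x ◂ c) (suc i) = at-extend c i

weight-extend : ∀ {n} (c : Code n) → weight (extend c) ≡ weight c
weight-extend ε       = refl
weight-extend (x ◂ c) = cong₂ _+_ (Fin.toℕ-inject₁ x) (weight-extend c)

good-≗ : ∀ {g h : ℕ → ℕ} → g ≗ h → Decreasing g × NoUpDown g → Decreasing h × NoUpDown h
good-≗ {g} {h} eq (dec , nud) =
  (λ i → subst₂ _≤_ (eq (suc i)) (eq i) (dec i)) ,
  (λ {i} {j} i<j hi≡ → subst₂ _≤_ (eq j) (cong suc (eq (suc j)))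
     (nud i<j (trans (eq i) (trans hi≡ (sym (eq (suc i)))))))

-- The last entry of any code is 0. In a decreasing code of weight `k`, each nonzero entry satisfies
-- `at e i + i ≤ k < r`, so dropping the last entry leaves a code of length `r`.
Card-extend : ∀ {r k n} → k < r → Card (GoodCode r k) n → Card (GoodCode (suc r) k) n
Card-extend {r} {k} k<r = Card-bij extend
  (λ {c} (w , good) → trans (weight-extend c) w , good-≗ (sym ∘ at-extend c) good)
  (λ {c} {d} _ _ eq → at-injective c d λ i →
    trans (sym (at-extend c i)) (trans (cong (λ e → at e i) eq) (at-extend d i)))
  surj
  where
  surj : ∀ {e} → GoodCode (suc r) k e → ∃ λ c → GoodCode r k c × extend c ≡ e
  surj {e} (w , dec , nud) = c ,
    (trans (sym (weight-extend c)) (trans (cong weight extend≡) w) , good-≗ same (dec , nud)) , extend≡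
    where
    bound : ∀ i → i < r → at e i + i < r
    bound i i<r with at e i ≟ 0
    ... | yes eq = subst (λ a → a + i < r) (sym eq) i<r
    ... | no  neq = ≤-<-trans (Σ<-lower dec (m<n⇒m<1+n i<r) (n≢0⇒n>0 neq))
                              (subst (_< r) (trans (sym w) (weight≡Σ< e)) k<r)
    c = proj₁ (code-with r (at e) bound)
    same : at e ≗ at c
    same i with <-cmp i r
    ... | tri< i<r _ _ = sym (proj₂ (code-with r (at e) bound) i i<r)
    ... | tri≈ _ refl _ = trans (n≤0⇒n≡0 (+-cancelʳ-≤ r (at e r) 0 (s≤s⁻¹ (at-bound e ≤-refl))))
                                (sym (at-beyond c ≤-refl))
    ... | tri> _ _ r<i = trans (at-beyond e r<i) (sym (at-beyond c (<⇒≤ r<i)))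
    extend≡ : extend c ≡ e
    extend≡ = at-injective (extend c) e λ i → trans (at-extend c i) (sym (same i))

-- The counts for k missing pennies agree from r = k + 1 on.
a : PowerSeries
a k = numConvex (triangle (suc k) ∸ k) (suc k)

r≤triangle : ∀ r → r ≤ triangle r
r≤triangle zero    = z≤n
r≤triangle (suc r) = m≤m+n (suc r) (triangle r)

Card-a : ∀ {k r} → k < r → Card (GoodCode r k) (a k)
Card-a {k} {suc r} (s≤s k≤r) with m≤n⇒m<n∨m≡n k≤r
... | inj₁ k<r  = Card-extend k<r (Card-a k<r)
... | inj₂ refl = Card-GoodCode (≤-trans (n≤1+n k) (r≤triangle (suc k))) (Card-penny (suc k) k)

a-A005576 : IsA005576 a
a-A005576 k = suc k , λ r k<r → trans (cong (λ N → numConvex (N ∸ k) r) (triangle≡ r))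
  (Card-unique (Card-GoodCode (≤-trans (<⇒≤ k<r) (r≤triangle r)) (Card-penny r k)) (Card-a k<r))

-- Permutations in one-line notation

decode : ∀ {n} → Code n → Vec (Fin n) n
decode ε       = []
decode (x ◂ c) = x ∷ Vec.map (punchIn x) (decode c)

lookup-decode : ∀ {n} (c : Code n) i → toℕ (lookup (decode c) i) ≡ val c (toℕ i)
lookup-decode (x ◂ c) Fin.zero    = refl
lookup-decode (x ◂ c) (Fin.suc i) = trans
  (cong toℕ (lookup-map i (punchIn x) (decode c)))
  (trans (toℕ-punchIn x (lookup (decode c) i)) (cong (punch (toℕ x)) (lookup-decode c i)))

decode-unique : ∀ {n} (c : Code n) → VecUnique (decode c)
decode-unique ε       = []
decode-unique (x ◂ c) =
  VecAll.map⁺ (VecAll.universal (λ v → Fin.punchInᵢ≢i x v ∘ sym) (decode c)) ∷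
  VecUnique.map⁺ (λ {v} {w} → Fin.punchIn-injective x v w) (decode-unique c)

map-injective : ∀ {A B : Set} {f : A → B} → (∀ {x y} → f x ≡ f y → x ≡ y) →
                ∀ {n} {v w : Vec A n} → Vec.map f v ≡ Vec.map f w → v ≡ w
map-injective inj {v = []}    {[]}    eq = refl
map-injective inj {v = x ∷ v} {y ∷ w} eq with fx≡fy , eqs ← ∷-injective eq =
  cong₂ _∷_ (inj fx≡fy) (map-injective inj eqs)

decode-injective : ∀ {n} (c d : Code n) → decode c ≡ decode d → c ≡ d
decode-injective ε       ε       eq = refl
decode-injective (x ◂ c) (y ◂ d) eq with refl , eqs ← ∷-injective eq =
  cong (x ◂_) (decode-injective c d (map-injective (λ {v} {w} → Fin.punchIn-injective x v w) eqs))

Unique-map⁻ : ∀ {A B : Set} {f : A → B} {n} {v : Vec A n} → VecUnique (Vec.map f v) → VecUnique v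
Unique-map⁻         {v = []}    _        = []
Unique-map⁻ {f = f} {v = x ∷ v} (x∉ ∷ u) = VecAll.map (λ fx≢ → fx≢ ∘ cong f) (VecAll.map⁻ x∉) ∷ Unique-map⁻ u

punchOuts : ∀ {m n} {x : Fin (suc n)} {v : Vec (Fin (suc n)) m} → VecAll.All (x ≢_) v →
            ∃ λ w → Vec.map (punchIn x) w ≡ v
punchOuts []         = [] , refl
punchOuts (x≢y ∷ x∉) with w , eq ← punchOuts x∉ = punchOut x≢y ∷ w , cong₂ _∷_ (Fin.punchIn-punchOut x≢y) eq

encode : ∀ {n} (π : Vec (Fin n) n) → VecUnique π → ∃ λ c → decode c ≡ π
encode []              _       = ε , refl
encode {suc n} (x ∷ π) (x∉ ∷ u)
  with w , refl ← punchOuts x∉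
  with c , refl ← encode w (Unique-map⁻ u) = x ◂ c , refl

-- Inversions and the weight of a code

Inversion : ∀ {n} → (ℕ → ℕ) → Fin n × Fin n → Set
Inversion g (i , j) = toℕ i < toℕ j × g (toℕ j) < g (toℕ i)

Card-inversions : ∀ {n} (c : Code n) → Card (Inversion (val c)) (inversions (decode c))
Card-inversions {n} c = Card-cong
  (λ { {i , j} (_ , i<j , inv) → i<j , subst₂ _<_ (lookup-decode c j) (lookup-decode c i) inv })
  (λ { {i , j} (i<j , inv) → _ , i<j , subst₂ _<_ (sym (lookup-decode c j)) (sym (lookup-decode c i)) inv })
  (Card-filter _ pairs)
  where
  pairs : Card {Fin n × Fin n} U (length (cartesianProduct (allFin n) (allFin n)))
  pairs = card _ (Unique.cartesianProduct⁺ (Unique.allFin⁺ n) (Unique.allFin⁺ n)) (λ _ → _)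
    (λ { {i , j} _ → ∈-cartesianProduct⁺ (∈-allFin i) (∈-allFin j) }) refl

Card-Fin : ∀ n → Card {Fin n} U n
Card-Fin n = card (allFin n) (Unique.allFin⁺ n) (λ _ → _) (λ {i} _ → ∈-allFin i) (length-tabulate id)

position : ∀ {n} (c : Code n) {v} → v < n → ∃ λ (i : Fin n) → val c (toℕ i) ≡ v
position {n} c {v} v<n with i , eq ← val-surjective c v with i <? n
... | yes i<n = fromℕ< i<n , trans (cong (val c) (Fin.toℕ-fromℕ< i<n)) eq
... | no  i≮n = ⊥-elim (<⇒≱ v<n (subst (n ≤_) (trans (sym (val-beyond c (≮⇒≥ i≮n))) eq) (≮⇒≥ i≮n)))

Card-below : ∀ {n} (c : Code n) {x} → x ≤ n → Card {Fin n} (λ i → val c (toℕ i) < x) x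
Card-below {n} c {x} x≤n = Card-bij (proj₁ ∘ pos)
  (λ {v} _ → subst (_< x) (sym (proj₂ (pos v))) (Fin.toℕ<n v))
  (λ {v} {w} _ _ eq → Fin.toℕ-injective
    (trans (sym (proj₂ (pos v))) (trans (cong (val c ∘ toℕ) eq) (proj₂ (pos w)))))
  (λ {i} lt → fromℕ< lt , _ , Fin.toℕ-injective (val-injective c (trans (proj₂ (pos _)) (Fin.toℕ-fromℕ< lt))))
  (Card-Fin x)
  where
  pos : ∀ (v : Fin x) → ∃ λ (i : Fin n) → val c (toℕ i) ≡ toℕ v
  pos v = position c (<-≤-trans (Fin.toℕ<n v) x≤n)

-- Inversions with left end 0 correspond to the `toℕ x` tail positions with value below `x`. The
-- others are the inversions of the tail, because `punch` preserves order.
Card-weight : ∀ {n} (c : Code n) → Card (Inversion (val c)) (weight c)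
Card-weight ε = card [] [] (λ ()) (λ { {() , _} }) refl
Card-weight {suc n} (x ◂ c) = Card-cong to from (Card-⊎ (λ { (_ , _ , refl) ((_ , _) , _ , ()) })
  (Card-bij {Q = First} (λ j → Fin.zero , Fin.suc j) (λ {j} lt → j , lt , refl) (λ { _ _ refl → refl })
    (λ { (j , lt , refl) → j , lt , refl }) (Card-below c (s≤s⁻¹ (Fin.toℕ<n x))))
  (Card-bij {Q = Later} (λ (i , j) → Fin.suc i , Fin.suc j) (λ {ij} inv → ij , inv , refl) (λ { _ _ refl → refl })
    (λ { (ij , inv , refl) → ij , inv , refl }) (Card-weight c)))
  where
  First Later : Fin (suc n) × Fin (suc n) → Set
  First p = ∃ λ j → val c (toℕ j) < toℕ x × (Fin.zero , Fin.suc j) ≡ p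
  Later p = ∃ λ ((i , j) : Fin n × Fin n) → Inversion (val c) (i , j) × (Fin.suc i , Fin.suc j) ≡ p
  to : ∀ {p} → First p ⊎ Later p → Inversion (val (x ◂ c)) p
  to (inj₁ (j , lt , refl)) = s≤s z≤n , subst (_< toℕ x) (sym (punch-< lt)) lt
  to (inj₂ ((i , j) , (i<j , inv) , refl)) = s≤s i<j , punch-mono-< (toℕ x) inv
  from : ∀ {p} → Inversion (val (x ◂ c)) p → First p ⊎ Later p
  from {Fin.zero  , Fin.zero}  (() , _)
  from {Fin.suc i , Fin.zero}  (() , _)
  from {Fin.zero  , Fin.suc j} (_ , inv) = inj₁ (j , ≤-<-trans (≤-punch (toℕ x) _) inv , refl)
  from {Fin.suc i , Fin.suc j} (s≤s i<j , inv) = inj₂ ((i , j) , (i<j , punch-cancel-< (toℕ x) inv) , refl)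

inversions-decode : ∀ {n} (c : Code n) → inversions (decode c) ≡ weight c
inversions-decode c = Card-unique (Card-inversions c) (Card-weight c)

-- Reverse complements

rc : ∀ {n} → Vec (Fin n) n → Vec (Fin n) n
rc π = tabulate λ i → opposite (lookup π (opposite i))

opposite-injective : ∀ {n} {i j : Fin n} → opposite i ≡ opposite j → i ≡ j
opposite-injective {i = i} {j} eq =
  trans (sym (Fin.opposite-involutive i)) (trans (cong opposite eq) (Fin.opposite-involutive j))

rc-unique : ∀ {n} {π : Vec (Fin n) n} → VecUnique π → VecUnique (rc π)
rc-unique u = VecUnique.tabulate⁺ λ eq →
  opposite-injective (VecUnique.lookup-injective u _ _ (opposite-injective eq))

rc-involutive : ∀ {n} (π : Vec (Fin n) n) → rc (rc π) ≡ π
rc-involutive π = trans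
  (tabulate-cong λ i → trans (cong opposite (lookup∘tabulate _ (opposite i)))
    (trans (Fin.opposite-involutive _) (cong (lookup π) (Fin.opposite-involutive i))))
  (tabulate∘lookup π)

rcCode : ∀ {n} → Code n → Code n
rcCode c = proj₁ (encode (rc (decode c)) (rc-unique (decode-unique c)))

decode-rcCode : ∀ {n} (c : Code n) → decode (rcCode c) ≡ rc (decode c)
decode-rcCode c = proj₂ (encode (rc (decode c)) (rc-unique (decode-unique c)))

rcCode-involutive : ∀ {n} (c : Code n) → rcCode (rcCode c) ≡ c
rcCode-involutive c = decode-injective _ c
  (trans (decode-rcCode (rcCode c)) (trans (cong rc (decode-rcCode c)) (rc-involutive (decode c))))

-- Stated for functions on ℕ so that patterns transfer without `Fin`; the bound on `g i` keeps the
-- complement from truncating.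
record ReverseComplement (n : ℕ) (g h : ℕ → ℕ) : Set where
  constructor reverseComplement
  field
    rel : ∀ {i} → i < n → g i < n × h (n ∸ suc i) ≡ n ∸ suc (g i)

val-rcCode : ∀ {n} (c : Code n) → ReverseComplement n (val c) (val (rcCode c))
val-rcCode {n} c = reverseComplement λ {i} i<n → let open ≡-Reasoning; i′ = fromℕ< i<n in val-bound c i<n , (begin
  val (rcCode c) (n ∸ suc i)
    ≡⟨ cong (λ k → val (rcCode c) (n ∸ suc k)) (Fin.toℕ-fromℕ< i<n) ⟨
  val (rcCode c) (n ∸ suc (toℕ i′))
    ≡⟨ cong (val (rcCode c)) (Fin.opposite-prop i′) ⟨
  val (rcCode c) (toℕ (opposite i′))
    ≡⟨ lookup-decode (rcCode c) (opposite i′) ⟨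
  toℕ (lookup (decode (rcCode c)) (opposite i′))
    ≡⟨ cong (λ π → toℕ (lookup π (opposite i′))) (decode-rcCode c) ⟩
  toℕ (lookup (rc (decode c)) (opposite i′))
    ≡⟨ cong toℕ (lookup∘tabulate _ (opposite i′)) ⟩
  toℕ (opposite (lookup (decode c) (opposite (opposite i′))))
    ≡⟨ cong (λ j → toℕ (opposite (lookup (decode c) j))) (Fin.opposite-involutive i′) ⟩
  toℕ (opposite (lookup (decode c) i′))
    ≡⟨ Fin.opposite-prop (lookup (decode c) i′) ⟩
  n ∸ suc (toℕ (lookup (decode c) i′))
    ≡⟨ cong (λ v → n ∸ suc v) (lookup-decode c i′) ⟩
  n ∸ suc (val c (toℕ i′))
    ≡⟨ cong (λ k → n ∸ suc (val c k)) (Fin.toℕ-fromℕ< i<n) ⟩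
  n ∸ suc (val c i) ∎)

flip-< : ∀ {n i j} → i < j → j < n → n ∸ suc j < n ∸ suc i
flip-< i<j j<n = ∸-monoʳ-< (s≤s i<j) j<n

flip-bound : ∀ {n i} → i < n → n ∸ suc i < n
flip-bound {suc n} {i} _ = s≤s (m∸n≤m n i)

RC-< : ∀ {n g h} → ReverseComplement n g h → ∀ {i j} →
       i < n → j < n → g i < g j → h (n ∸ suc j) < h (n ∸ suc i)
RC-< (reverseComplement rel) i<n j<n lt = subst₂ _<_
  (sym (proj₂ (rel j<n))) (sym (proj₂ (rel i<n))) (flip-< lt (proj₁ (rel j<n)))

-- 213 and 132 are reverse complements of each other, and 3412 is its own.
Has213⇒132-rc : ∀ {n g h} → ReverseComplement n g h → Has213 n g → Has132 n h
Has213⇒132-rc {n} rel (i , j , k , i<j , j<k , k<n , p , q) =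
  n ∸ suc k , n ∸ suc j , n ∸ suc i , flip-< j<k k<n , flip-< i<j j<n , flip-bound i<n ,
  RC-< rel i<n k<n q , RC-< rel j<n i<n p
  where
  j<n = <-trans j<k k<n
  i<n = <-trans i<j j<n

Has132⇒213-rc : ∀ {n g h} → ReverseComplement n g h → Has132 n g → Has213 n h
Has132⇒213-rc {n} rel (i , j , k , i<j , j<k , k<n , p , q) =
  n ∸ suc k , n ∸ suc j , n ∸ suc i , flip-< j<k k<n , flip-< i<j j<n , flip-bound i<n ,
  RC-< rel k<n j<n q , RC-< rel i<n k<n p
  where
  j<n = <-trans j<k k<n
  i<n = <-trans i<j j<n

Has3412-rc : ∀ {n g h} → ReverseComplement n g h → Has3412 n g → Has3412 n h
Has3412-rc {n} rel (i , j , k , l , i<j , j<k , k<l , l<n , p , q , r) =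
  n ∸ suc l , n ∸ suc k , n ∸ suc j , n ∸ suc i ,
  flip-< k<l l<n , flip-< j<k k<n , flip-< i<j j<n , flip-bound i<n ,
  RC-< rel i<n j<n r , RC-< rel l<n i<n q , RC-< rel k<n l<n p
  where
  k<n = <-trans k<l l<n
  j<n = <-trans j<k k<n
  i<n = <-trans i<j j<n

-- Reversing both positions and values turns the inversion `(i , j)` into the inversion
-- `(opposite j , opposite i)`.
weight-rcCode : ∀ {n} (c : Code n) → weight (rcCode c) ≡ weight c
weight-rcCode {n} c = Card-unique (Card-weight (rcCode c))
  (Card-bij flip (λ {ij} → flips c {ij})
    (λ { _ _ eq → cong₂ _,_ (opposite-injective (cong proj₂ eq)) (opposite-injective (cong proj₁ eq)) })
    (λ { {i , j} inv → flip (i , j) , flips′ (i , j) inv ,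
      cong₂ _,_ (Fin.opposite-involutive i) (Fin.opposite-involutive j) })
    (Card-weight c))
  where
  flip : Fin n × Fin n → Fin n × Fin n
  flip (i , j) = opposite j , opposite i
  flips : ∀ c {ij} → Inversion (val c) ij → Inversion (val (rcCode c)) (flip ij)
  flips c {i , j} (i<j , inv) = subst₂ (λ a b → a < b × val (rcCode c) b < val (rcCode c) a)
    (sym (Fin.opposite-prop j)) (sym (Fin.opposite-prop i))
    (flip-< i<j (Fin.toℕ<n j) , RC-< (val-rcCode c) (Fin.toℕ<n j) (Fin.toℕ<n i) inv)
  flips′ : ∀ ij → Inversion (val (rcCode c)) ij → Inversion (val c) (flip ij)
  flips′ ij inv = subst (λ d → Inversion (val d) (flip ij)) (rcCode-involutive c) (flips (rcCode c) inv)

-- The two summands of a long avoider of 1324 and 3412.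
Lower Upper : ∀ {n} → ℕ → Code n → Set
Lower {n} k c = weight c ≡ k × ¬ Has132 n (val c) × ¬ Has3412 n (val c)
Upper {n} k c = weight c ≡ k × ¬ Has213 n (val c) × ¬ Has3412 n (val c)

Card-Lower : ∀ {n k} → k < n → Card (Lower {n} k) (a k)
Card-Lower k<n = Card-cong
  (λ {c} (w , dec , nud) → w , Decreasing⇒¬132 c dec , NoUpDown⇒¬3412 c dec nud)
  (λ {c} (w , ¬132 , ¬3412) → let dec = ¬132⇒Decreasing c ¬132 in
    w , dec , λ {i} {j} → ¬3412⇒NoUpDown c dec ¬3412 {i} {j})
  (Card-a k<n)

Card-Upper : ∀ {n k} → k < n → Card (Upper {n} k) (a k)
Card-Upper {n} {k} k<n = Card-bij rcCode
  (λ {c} (w , ¬132 , ¬3412) → trans (weight-rcCode c) w ,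
    ¬132 ∘ back c Has213⇒132-rc , ¬3412 ∘ back c Has3412-rc)
  (λ {c} {d} _ _ eq → trans (sym (rcCode-involutive c)) (trans (cong rcCode eq) (rcCode-involutive d)))
  (λ {c} (w , ¬213 , ¬3412) → rcCode c ,
    (trans (weight-rcCode c) w , ¬213 ∘ back c Has132⇒213-rc , ¬3412 ∘ back c Has3412-rc) ,
    rcCode-involutive c)
  (Card-Lower k<n)
  where
  -- A pattern of `rcCode c` is transferred to the reverse complement of `rcCode c`, which is `c`.
  back : ∀ {P Q : ℕ → (ℕ → ℕ) → Set} c →
         (∀ {n g h} → ReverseComplement n g h → P n g → Q n h) → P n (val (rcCode c)) → Q n (val c)
  back {Q = Q} c transfer p = subst (λ d → Q n (val d)) (rcCode-involutive c) (transfer (val-rcCode (rcCode c)) p)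

-- Direct sums and cuts

infixr 6 _⊕_
-- No inversion runs between the summands of a direct sum, so its Lehmer code is the concatenation
-- of theirs.
_⊕_ : ∀ {s t} → Code s → Code t → Code (s + t)
ε       ⊕ d = d
(x ◂ c) ⊕ d = (x ↑ˡ _) ◂ (c ⊕ d)

weight-⊕ : ∀ {s t} (c : Code s) (d : Code t) → weight (c ⊕ d) ≡ weight c + weight d
weight-⊕ ε               d = refl
weight-⊕ {t = t} (x ◂ c) d = trans (cong₂ _+_ (Fin.toℕ-↑ˡ x t) (weight-⊕ c d)) (sym (+-assoc (toℕ x) _ _))

◂-injective : ∀ {n} {x y : Fin (suc n)} {c d : Code n} → x ◂ c ≡ y ◂ d → x ≡ y × c ≡ d
◂-injective refl = refl , refl

⊕-injective : ∀ {s t} (c c′ : Code s) {d d′ : Code t} → c ⊕ d ≡ c′ ⊕ d′ → c ≡ c′ × d ≡ d′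
⊕-injective ε       ε        eq = refl , eq
⊕-injective (x ◂ c) (y ◂ c′) eq
  with x≡y , eqs ← ◂-injective eq
  with refl , d≡d′ ← ⊕-injective c c′ eqs =
  cong (_◂ c) (Fin.↑ˡ-injective _ x y x≡y) , d≡d′

val-⊕ˡ : ∀ {s t} (c : Code s) (d : Code t) {i} → i < s → val (c ⊕ d) i ≡ val c i
val-⊕ˡ {t = t} (x ◂ c) d {zero}  _         = Fin.toℕ-↑ˡ x t
val-⊕ˡ {t = t} (x ◂ c) d {suc i} (s≤s i<s) = cong₂ punch (Fin.toℕ-↑ˡ x t) (val-⊕ˡ c d i<s)

val-⊕ʳ : ∀ {s t} (c : Code s) (d : Code t) i → val (c ⊕ d) (s + i) ≡ s + val d i
val-⊕ʳ ε d i = refl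
val-⊕ʳ {suc s} {t} (x ◂ c) d i = trans (cong₂ punch (Fin.toℕ-↑ˡ x t) (val-⊕ʳ c d i))
  (punch-≥ (≤-trans (s≤s⁻¹ (Fin.toℕ<n x)) (m≤m+n s _)))

-- Says that the first `p` entries form a code of length `p` by themselves, i.e. that the first `p`
-- positions carry the values below `p`.
Cut : ∀ {n} → Code n → ℕ → Set
Cut e p = ∀ i → i < p → at e i + i < p

split : ∀ s {t} (e : Code (s + t)) → Cut e s → ∃₂ λ (c : Code s) (d : Code t) → c ⊕ d ≡ e
split zero    e       cut = ε , e , refl
split (suc s) {t} (x ◂ e) cut with c , d , refl ← split s e
  (λ i i<s → s≤s⁻¹ (subst (_< suc s) (+-suc (at e i) i) (cut (suc i) (s≤s i<s)))) =
  fromℕ< x<s ◂ c , d , cong (_◂ (c ⊕ d)) (Fin.toℕ-injective (trans (Fin.toℕ-↑ˡ _ t) (Fin.toℕ-fromℕ< x<s)))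
  where
  x<s : toℕ x < suc s
  x<s = subst (_< suc s) (+-identityʳ (toℕ x)) (cut 0 (s≤s z≤n))

cut-< : ∀ {n} (e : Code n) {p} → Cut e p → ∀ {j} → j < p → val e j < p
cut-< e cut {j} j<p = ≤-<-trans (val≤at+ e j) (cut j j<p)

-- For a cut at `suc p` the head is at most `p`, so punching it raises every tail value that is at
-- least `p`.
cut-≥ : ∀ {n} (e : Code n) {p} → Cut e p → ∀ {j} → p ≤ j → p ≤ val e j
cut-≥ e       {zero}  cut p≤j = z≤n
cut-≥ ε       {suc p} cut p≤j = p≤j
cut-≥ (x ◂ e) {suc p} cut {suc j} (s≤s p≤j) = subst (suc p ≤_) (sym (punch-≥ (≤-trans x≤p below))) (s≤s below)
  where
  x≤p : toℕ x ≤ p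
  x≤p = s≤s⁻¹ (subst (_< suc p) (+-identityʳ (toℕ x)) (cut 0 (s≤s z≤n)))
  below : p ≤ val e j
  below = cut-≥ e (λ i i<p → s≤s⁻¹ (subst (_< suc p) (+-suc (at e i) i) (cut (suc i) (s≤s i<p)))) p≤j

-- The entry at i rules out cuts at i + 1, …, i + at e i, so a code has at most
-- weight many non-cuts.
noncuts : ∀ {n} → Code n → List ℕ
noncuts ε       = []
noncuts (x ◂ e) = List.map suc (upTo (toℕ x)) ++ List.map suc (noncuts e)

length-noncuts : ∀ {n} (e : Code n) → length (noncuts e) ≡ weight e
length-noncuts ε       = refl
length-noncuts (x ◂ e) = trans (length-++ (List.map suc (upTo (toℕ x)))) (cong₂ _+_
  (trans (length-map suc (upTo (toℕ x))) (length-upTo (toℕ x)))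
  (trans (length-map suc (noncuts e)) (length-noncuts e)))

∈-noncuts : ∀ {n} (e : Code n) {i p} → i < p → p ≤ at e i + i → p ∈ noncuts e
∈-noncuts ε {i} i<p p≤i = ⊥-elim (<⇒≱ i<p p≤i)
∈-noncuts (x ◂ e) {zero}  {suc p} _ p≤x = ∈-++⁺ˡ (∈-map⁺ suc (∈-upTo⁺ (subst (p <_) (+-identityʳ (toℕ x)) p≤x)))
∈-noncuts (x ◂ e) {suc i} {suc p} (s≤s i<p) p≤ = ∈-++⁺ʳ _ (∈-map⁺ suc
  (∈-noncuts e i<p (s≤s⁻¹ (subst (suc p ≤_) (+-suc (at e i) i) p≤))))

-- The `m` candidates from `l` on outnumber the non-cuts, so one of them is a cut.
cut-exists : ∀ {n} (e : Code n) l {m} → weight e < m → ∃ λ p → l ≤ p × p < l + m × Cut e p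
cut-exists e l {m} w<m with anyUpTo? (λ p → ¬? (DecMembership._∈?_ _≟_ (l + p) (noncuts e))) m
... | yes (p , p<m , ∉) = l + p , m≤m+n l p , +-monoʳ-< l p<m ,
  λ i i<p → ≰⇒> (∉ ∘ ∈-noncuts e i<p)
... | no none = ⊥-elim (<⇒≱ w<m (begin
  m                             ≡⟨ length-upTo m ⟨
  length (upTo m)               ≡⟨ length-map (l +_) (upTo m) ⟨
  length (List.map (l +_) (upTo m))
    ≤⟨ Unique∧⊆⇒length≤ (Unique.map⁺ (+-cancelˡ-≡ l _ _) (Unique.upTo⁺ m)) all ⟩
  length (noncuts e)            ≡⟨ length-noncuts e ⟩
  weight e                      ∎))
  where
  open ≤-Reasoning
  all : ∀ {p} → p ∈ List.map (l +_) (upTo m) → p ∈ noncuts e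
  all p∈ with q , q∈ , refl ← ∈-map⁻ (l +_) p∈ =
    decidable-stable (DecMembership._∈?_ _≟_ (l + q) (noncuts e)) λ ∉ → none (q , ∈-upTo⁻ q∈ , ∉)

-- If s is not a cut, it lies strictly between two cuts. An inversion between
-- these, preceded and followed by further entries, is the 32 of a 1324.
¬1324⇒Cut : ∀ {n} (e : Code n) {s} → weight e < s → s + weight e < n → ¬ Has1324 n (val e) → Cut e s
¬1324⇒Cut {n} e {s} w<s s+w<n avoid i i<s with at e i + i <? s
... | yes lt = lt
... | no  nlt with s≤λi+i ← ≮⇒≥ nlt
  -- The cut `p` is found in 1, ..., `s` and `q` in `s`, ..., `s + weight e`. Position 0, before
  -- `p`, serves as the 1, and position `q` as the 4.
  with p , 1≤p , p≤s , cutₚ ← cut-exists e 1 w<s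
     | q , s≤q , q<s+w , cut-q ← cut-exists e s (≤-refl {suc (weight e)})
     | j , i<j , inv ← at>0⇒inversion e i (+-cancelʳ-< i 0 _ (<-≤-trans i<s s≤λi+i)) =
  ⊥-elim (avoid (0 , i , j , q , ≤-trans 1≤p p≤i , i<j , j<q , q<n ,
    <-≤-trans (cut-< e cutₚ 1≤p) (cut-≥ e cutₚ (≤-trans p≤i (<⇒≤ i<j))) , inv ,
    <-≤-trans πi<q (cut-≥ e cut-q ≤-refl)))
  where
  p≤i : p ≤ i
  -- An `i` before the cut `p` would satisfy `at e i + i < p ≤ s`, contrary to the choice of `i`.
  p≤i = ≮⇒≥ λ i<p → <⇒≱ (<-≤-trans (cutₚ i i<p) (s≤s⁻¹ p≤s)) s≤λi+i
  i<q : i < q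
  i<q = <-≤-trans i<s s≤q
  πi<q : val e i < q
  πi<q = cut-< e cut-q i<q
  j<q : j < q
  j<q = ≰⇒> λ q≤j → <⇒≱ (<-trans inv πi<q) (cut-≥ e cut-q q≤j)
  q<n : q < n
  q<n = ≤-<-trans (s≤s⁻¹ (subst (q <_) (+-suc s (weight e)) q<s+w)) s+w<n

-- Patterns in direct sums

module _ {s t} (c : Code s) (d : Code t) where

  private
    π = val (c ⊕ d)

    low : ∀ {i} → i < s → π i < s
    low i<s = subst (_< s) (sym (val-⊕ˡ c d i<s)) (val-bound c i<s)

    high : ∀ i → s ≤ π (s + i)
    high i = subst (s ≤_) (sym (val-⊕ʳ c d i)) (m≤m+n s _)

    low⁻¹ : ∀ {i} → π i < s → i < s
    low⁻¹ {i} πi<s with i <? s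
    ... | yes i<s = i<s
    ... | no  i≮s with j , refl ← m≤n⇒∃[o]m+o≡n (≮⇒≥ i≮s) = ⊥-elim (<⇒≱ πi<s (high j))

    ≥⇒+ : ∀ {i} → s ≤ i → ∃ λ j → s + j ≡ i
    ≥⇒+ s≤i = m≤n⇒∃[o]m+o≡n s≤i

    lowˡ : ∀ {i j} → i < s → j < s → val c i < val c j → π i < π j
    lowˡ i<s j<s = subst₂ _<_ (sym (val-⊕ˡ c d i<s)) (sym (val-⊕ˡ c d j<s))

    low⁻ : ∀ {i j} → i < s → j < s → π i < π j → val c i < val c j
    low⁻ i<s j<s = subst₂ _<_ (val-⊕ˡ c d i<s) (val-⊕ˡ c d j<s)

    high⁺ : ∀ {i j} → val d i < val d j → π (s + i) < π (s + j)
    high⁺ {i} {j} = subst₂ _<_ (sym (val-⊕ʳ c d i)) (sym (val-⊕ʳ c d j)) ∘ +-monoʳ-< s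

    high⁻ : ∀ {i j} → π (s + i) < π (s + j) → val d i < val d j
    high⁻ {i} {j} = +-cancelˡ-< s _ _ ∘ subst₂ _<_ (val-⊕ʳ c d i) (val-⊕ʳ c d j)

    shift⁻ : ∀ {i j} → s + i < s + j → i < j
    shift⁻ = +-cancelˡ-< s _ _

  Has132⇒Has1324-⊕ : 0 < t → Has132 s (val c) → Has1324 (s + t) π
  Has132⇒Has1324-⊕ 0<t (i , j , k , i<j , j<k , k<s , p , q) =
    -- The first position of the upper summand serves as the 4.
    i , j , k , s + 0 , i<j , j<k , <-≤-trans k<s (m≤m+n s 0) , +-monoʳ-< s 0<t ,
    lowˡ i<s k<s p , lowˡ k<s j<s q , <-≤-trans (low j<s) (high 0)
    where
    j<s = <-trans j<k k<s
    i<s = <-trans i<j j<s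

  Has213⇒Has1324-⊕ : 0 < s → Has213 t (val d) → Has1324 (s + t) π
  Has213⇒Has1324-⊕ 0<s (i , j , k , i<j , j<k , k<t , p , q) =
    -- The first position of the lower summand serves as the 1.
    0 , s + i , s + j , s + k , <-≤-trans 0<s (m≤m+n s i) ,
    +-monoʳ-< s i<j , +-monoʳ-< s j<k , +-monoʳ-< s k<t ,
    <-≤-trans (low 0<s) (high j) , high⁺ p , high⁺ q

  Has3412ˡ : Has3412 s (val c) → Has3412 (s + t) π
  Has3412ˡ (i , j , k , l , i<j , j<k , k<l , l<s , p , q , r) =
    i , j , k , l , i<j , j<k , k<l , <-≤-trans l<s (m≤m+n s t) ,
    lowˡ k<s l<s p , lowˡ l<s i<s q , lowˡ i<s j<s r
    where
    k<s = <-trans k<l l<s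
    j<s = <-trans j<k k<s
    i<s = <-trans i<j j<s

  Has3412ʳ : Has3412 t (val d) → Has3412 (s + t) π
  Has3412ʳ (i , j , k , l , i<j , j<k , k<l , l<t , p , q , r) =
    s + i , s + j , s + k , s + l ,
    +-monoʳ-< s i<j , +-monoʳ-< s j<k , +-monoʳ-< s k<l , +-monoʳ-< s l<t ,
    high⁺ p , high⁺ q , high⁺ r

  -- The 2, at `k`, decides. If it is in the lower summand, so are the 1 and the 3 before it, a 132.
  -- Otherwise the larger 3 is in the upper summand too, and with the 2 and the 4 it forms a 213.
  Has1324-⊕ : Has1324 (s + t) π → Has132 s (val c) ⊎ Has213 t (val d)
  Has1324-⊕ (i , j , k , l , i<j , j<k , k<l , l<n , p , q , r) with k <? s
  ... | yes k<s = inj₁ (i , j , k , i<j , j<k , k<s , low⁻ i<s k<s p , low⁻ k<s j<s q)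
    where
    j<s = <-trans j<k k<s
    i<s = <-trans i<j j<s
  ... | no  k≮s
    with s≤j ← ≮⇒≥ (λ j<s → k≮s (low⁻¹ (<-trans q (low j<s))))
    with j′ , refl ← ≥⇒+ s≤j
       | k′ , refl ← ≥⇒+ (≮⇒≥ k≮s)
       | l′ , refl ← ≥⇒+ (≤-trans (≮⇒≥ k≮s) (<⇒≤ k<l)) =
    inj₂ (j′ , k′ , l′ , shift⁻ j<k , shift⁻ k<l , shift⁻ l<n , high⁻ q , high⁻ r)

  -- 3412 is no direct sum: if its last entry 2 is in the upper summand, then so is the larger first
  -- entry 3, and with it everything in between.
  Has3412-⊕ : Has3412 (s + t) π → Has3412 s (val c) ⊎ Has3412 t (val d)
  Has3412-⊕ (i , j , k , l , i<j , j<k , k<l , l<n , p , q , r) with l <? s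
  ... | yes l<s = inj₁ (i , j , k , l , i<j , j<k , k<l , l<s ,
      low⁻ k<s l<s p , low⁻ l<s i<s q , low⁻ i<s j<s r)
    where
    k<s = <-trans k<l l<s
    j<s = <-trans j<k k<s
    i<s = <-trans i<j j<s
  ... | no  l≮s
    with s≤i ← ≮⇒≥ (λ i<s → l≮s (low⁻¹ (<-trans q (low i<s))))
    with i′ , refl ← ≥⇒+ s≤i
       | j′ , refl ← ≥⇒+ (≤-trans s≤i (<⇒≤ i<j))
       | k′ , refl ← ≥⇒+ (≤-trans s≤i (<⇒≤ (<-trans i<j j<k)))
       | l′ , refl ← ≥⇒+ (≮⇒≥ l≮s) =
    inj₂ (i′ , j′ , k′ , l′ , shift⁻ i<j , shift⁻ j<k , shift⁻ k<l , shift⁻ l<n ,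
      high⁻ p , high⁻ q , high⁻ r)

-- Avoiders as pairs of summands

Avoider : ∀ {n} → ℕ → Code n → Set
Avoider {n} k e = weight e ≡ k × ¬ Has1324 n (val e) × ¬ Has3412 n (val e)

Card-Avoider : ∀ {s t k} → k < s → k < t → Card (Avoider {s + t} k) ((a ²) k)
Card-Avoider {s} {t} {k} k<s k<t = Card-bij (uncurry _⊕_) (λ {cd} → sound {cd})
  (λ { {c , d} {c′ , d′} _ _ eq → let c≡ , d≡ = ⊕-injective c c′ eq in cong₂ _,_ c≡ d≡ })
  surj
  -- The index of the Cauchy sum is the weight of the lower summand.
  (Card-Σ {R = Pair} (upTo (suc k)) (Unique.upTo⁺ (suc k))
    (λ ((w , _) , _) ((w′ , _) , _) → trans (sym w) w′)
    λ {i} i∈ → Card-× (Card-Lower (≤-<-trans (s≤s⁻¹ (∈-upTo⁻ i∈)) k<s))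
                    (Card-Upper (≤-<-trans (m∸n≤m k i) k<t)))
  where
  Pair : ℕ → Code s × Code t → Set
  Pair i (c , d) = Lower i c × Upper (k ∸ i) d
  sound : ∀ {cd} → (∃ λ i → i ∈ upTo (suc k) × Pair i cd) → Avoider k (uncurry _⊕_ cd)
  sound {c , d} (i , i∈ , (w , ¬132 , ¬3412) , (w′ , ¬213 , ¬3412′)) =
    trans (weight-⊕ c d) (trans (cong₂ _+_ w w′) (m+[n∸m]≡n (s≤s⁻¹ (∈-upTo⁻ i∈)))) ,
    (λ h → [ ¬132 , ¬213 ]′ (Has1324-⊕ c d h)) , (λ h → [ ¬3412 , ¬3412′ ]′ (Has3412-⊕ c d h))
  surj : ∀ {e} → Avoider k e → ∃ λ cd → (∃ λ i → i ∈ upTo (suc k) × Pair i cd) × uncurry _⊕_ cd ≡ e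
  surj {e} (refl , ¬1324 , ¬3412) with c , d , refl ← split s e (¬1324⇒Cut e k<s (+-monoʳ-< s k<t) ¬1324) =
    (c , d) , (weight c , ∈-upTo⁺ (s≤s (subst (weight c ≤_) (sym w) (m≤m+n (weight c) (weight d)))) ,
      (refl , ¬1324 ∘ Has132⇒Has1324-⊕ c d (≤-<-trans z≤n k<t) , ¬3412 ∘ Has3412ˡ c d) ,
      (sym (trans (cong (_∸ weight c) w) (m+n∸m≡n (weight c) (weight d))) ,
       ¬1324 ∘ Has213⇒Has1324-⊕ c d (≤-<-trans z≤n k<s) , ¬3412 ∘ Has3412ʳ c d)) , refl
    where
    w = weight-⊕ c d

-- Pattern containment

increasing₄ : ∀ {n} {i j k l : Fin n} → i Fin.< j → j Fin.< k → k Fin.< l → Increasing (i ∷ j ∷ k ∷ l ∷ [])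
increasing₄ p q r 0F 1F _ = p
increasing₄ p q r 0F 2F _ = <-trans p q
increasing₄ p q r 0F 3F _ = <-trans p (<-trans q r)
increasing₄ p q r 1F 2F _ = q
increasing₄ p q r 1F 3F _ = <-trans q r
increasing₄ p q r 2F 3F _ = r
increasing₄ p q r 0F 0F ()
increasing₄ p q r 1F 1F (s≤s ())
increasing₄ p q r 2F 1F (s≤s ())
increasing₄ p q r 2F 2F (s≤s (s≤s ()))
increasing₄ p q r 3F 1F (s≤s ())
increasing₄ p q r 3F 2F (s≤s (s≤s ()))
increasing₄ p q r 3F 3F (s≤s (s≤s (s≤s ())))

-- w lists the values of u in increasing order.
sorted⇒OrderIsomorphic : ∀ {m n} (u w : Vec (Fin n) m) (q : Vec (Fin m) m) → Increasing w →
                         (∀ i → lookup u i ≡ lookup w (lookup q i)) → OrderIsomorphic u q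
sorted⇒OrderIsomorphic u w q inc u≡ i j = to , from
  where
  from : lookup q i Fin.< lookup q j → lookup u i Fin.< lookup u j
  from lt = subst₂ Fin._<_ (sym (u≡ i)) (sym (u≡ j)) (inc _ _ lt)
  to : lookup u i Fin.< lookup u j → lookup q i Fin.< lookup q j
  to lt with Fin.<-cmp (lookup q i) (lookup q j)
  ... | tri< p _ _ = p
  ... | tri≈ _ p _ = ⊥-elim (<-irrefl (cong toℕ (trans (u≡ i) (trans (cong (lookup w) p) (sym (u≡ j))))) lt)
  ... | tri> _ _ p = ⊥-elim (<-asym lt (subst₂ Fin._<_ (sym (u≡ j)) (sym (u≡ i)) (inc _ _ p)))

p1324 p3412 : Vec (Fin 4) 4
p1324 = 0F ∷ 2F ∷ 1F ∷ 3F ∷ []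
p3412 = 2F ∷ 3F ∷ 0F ∷ 1F ∷ []

module _ {n} (e : Code n) where

  private
    π = lookup (decode e)

    val⁺ : ∀ {i j} → π i Fin.< π j → val e (toℕ i) < val e (toℕ j)
    val⁺ {i} {j} = subst₂ _<_ (lookup-decode e i) (lookup-decode e j)

    val⁻ : ∀ {i j} → val e (toℕ i) < val e (toℕ j) → π i Fin.< π j
    val⁻ {i} {j} = subst₂ _<_ (sym (lookup-decode e i)) (sym (lookup-decode e j))

    index : ∀ {i} → i < n → ∃ λ (i′ : Fin n) → toℕ i′ ≡ i
    index i<n = fromℕ< i<n , Fin.toℕ-fromℕ< i<n

  Contains-1324⁻ : Contains (decode e) p1324 → Has1324 n (val e)
  Contains-1324⁻ (i ∷ j ∷ k ∷ l ∷ [] , inc , iso) = toℕ i , toℕ j , toℕ k , toℕ l ,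
    inc 0F 1F ≤-refl , inc 1F 2F ≤-refl , inc 2F 3F ≤-refl , Fin.toℕ<n l ,
    val⁺ (proj₂ (iso 0F 2F) ≤-refl) , val⁺ (proj₂ (iso 2F 1F) ≤-refl) , val⁺ (proj₂ (iso 1F 3F) ≤-refl)

  Contains-3412⁻ : Contains (decode e) p3412 → Has3412 n (val e)
  Contains-3412⁻ (i ∷ j ∷ k ∷ l ∷ [] , inc , iso) = toℕ i , toℕ j , toℕ k , toℕ l ,
    inc 0F 1F ≤-refl , inc 1F 2F ≤-refl , inc 2F 3F ≤-refl , Fin.toℕ<n l ,
    val⁺ (proj₂ (iso 2F 3F) ≤-refl) , val⁺ (proj₂ (iso 3F 0F) ≤-refl) , val⁺ (proj₂ (iso 0F 1F) ≤-refl)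

  Contains-1324⁺ : Has1324 n (val e) → Contains (decode e) p1324
  Contains-1324⁺ (i , j , k , l , i<j , j<k , k<l , l<n , p , q , r)
    with l′ , refl ← index l<n
    with k′ , refl ← index (<-trans k<l l<n)
    with j′ , refl ← index (<-trans j<k (<-trans k<l l<n))
    with i′ , refl ← index (<-trans i<j (<-trans j<k (<-trans k<l l<n))) =
    i′ ∷ j′ ∷ k′ ∷ l′ ∷ [] , increasing₄ i<j j<k k<l ,
    -- In order of value the 2, at `k′`, comes before the 3, at `j′`.
    sorted⇒OrderIsomorphic (Vec.map π (i′ ∷ j′ ∷ k′ ∷ l′ ∷ [])) (Vec.map π (i′ ∷ k′ ∷ j′ ∷ l′ ∷ [])) p1324
      (increasing₄ (val⁻ p) (val⁻ q) (val⁻ r))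
      λ { 0F → refl ; 1F → refl ; 2F → refl ; 3F → refl }

  Contains-3412⁺ : Has3412 n (val e) → Contains (decode e) p3412
  Contains-3412⁺ (i , j , k , l , i<j , j<k , k<l , l<n , p , q , r)
    with l′ , refl ← index l<n
    with k′ , refl ← index (<-trans k<l l<n)
    with j′ , refl ← index (<-trans j<k (<-trans k<l l<n))
    with i′ , refl ← index (<-trans i<j (<-trans j<k (<-trans k<l l<n))) =
    i′ ∷ j′ ∷ k′ ∷ l′ ∷ [] , increasing₄ i<j j<k k<l ,
    sorted⇒OrderIsomorphic (Vec.map π (i′ ∷ j′ ∷ k′ ∷ l′ ∷ [])) (Vec.map π (k′ ∷ l′ ∷ i′ ∷ j′ ∷ [])) p3412
      (increasing₄ (val⁻ p) (val⁻ q) (val⁻ r))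
      λ { 0F → refl ; 1F → refl ; 2F → refl ; 3F → refl }

-- From codes to the limit series

Counted : ∀ {n} → ℕ → Vec (Fin n) n → Set
Counted k π = VecUnique π × inversions π ≡ k × AvoidsAll 1324,3412 π

Card-av : ∀ n k → Card (Counted {n} k) (av n k 1324,3412)
Card-av n k = Card-cong (λ ((_ , u) , rest) → u , rest) (λ (u , rest) → (_ , u) , rest)
  (Card-filter (λ π → (inversions π ≟ k) ×-dec avoidsAll? 1324,3412 π)
    (Card-filter unique? (Card-words (Unique.allFin⁺ n) ∈-allFin n)))

Card-decode : ∀ {n k m} → Card (Avoider {n} k) m → Card (Counted {n} k) m
Card-decode = Card-bij decode
  (λ {e} (w , ¬1324 , ¬3412) → decode-unique e , trans (inversions-decode e) w ,
    (¬1324 ∘ Contains-1324⁻ e) ∷ (¬3412 ∘ Contains-3412⁻ e) ∷ [])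
  (λ {e} {e′} _ _ → decode-injective e e′)
  λ { {π} (u , w , ¬1324 ∷ ¬3412 ∷ []) → let e , eq = encode π u in
    e , (trans (sym (inversions-decode e)) (trans (cong inversions eq) w) ,
      (λ h → ¬1324 (subst (λ π → Contains π p1324) eq (Contains-1324⁺ e h))) ,
      (λ h → ¬3412 (subst (λ π → Contains π p3412) eq (Contains-3412⁺ e h)))) , eq }

-- From length `2 * (k + 1)` on, cutting after `k + 1` positions leaves both summands longer than
-- `k`, where their counts have stabilised.
a²-limit : IsLimitSeries 1324,3412 (a ²)
a²-limit k = suc k + suc k , λ n large →
  let t , eq = m≤n⇒∃[o]m+o≡n (≤-trans (m≤m+n (suc k) (suc k)) large)
      k<t    = +-cancelˡ-≤ (suc k) (suc k) t (subst (suc k + suc k ≤_) (sym eq) large)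
  in subst (λ n → av n k 1324,3412 ≡ (a ²) k) eq
       (Card-unique (Card-av (suc k + t) k) (Card-decode (Card-Avoider {suc k} {t} ≤-refl k<t)))

proposition5p14 : ∃₂ λ (a C : PowerSeries) →
    IsA005576 a × IsLimitSeries 1324,3412 C × C ≗ a ²
proposition5p14 = a , a ² , a-A005576 , a²-limit , λ _ → refl
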